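{- Let $n\geq2$ and $k\geq1$ be integers. The multiple zeta value $\zeta(\{n\}^k)$ of length $k$ can be expressed as a linear combination of products of ordinary Riemann $\zeta$ values. In particular, $$\zeta(\{n\}^k)=(-1)^k\left[z^{nk}\right]\exp\left(-\sum_{j\geq1}\frac{\zeta(nj)}{j}z^{nj}\right).$$
   Context: $\zeta(\cdot)$ with one argument is the Riemann zeta function. $\zeta(\{n\}^k):=\sum_{n_1>n_2>\dots>n_k\geq1}\frac{1}{(n_1n_2\cdots n_k)^n}$. $[z^N]f$ denotes the coefficient of $z^N$ in the power series $f$. -}

module Defs where

open import Data.Nat.Base as ℕ using (ℕ; zero; suc; NonZero; NonTrivial; _!)
import Data.Nat.Properties as ℕ
open import Data.Integer.Base as ℤ using (ℤ; +_)
import Data.Integer.Properties as ℤ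
open import Data.Rational.Base hiding (_≃_; NonZero)
open import Data.Rational.Properties
open import Data.Rational.Solver using (module +-*-Solver)
open import Data.Rational.Unnormalised.Base as ℚᵘ using (mkℚᵘ)
import Data.Rational.Unnormalised.Properties as ℚᵘ
open import Data.List.Base using (List; []; _∷_; _++_; map; foldr)
open import Data.List.Properties using (map-++)
open import Data.List.NonEmpty.Base using (List⁺; toList)
open import Data.Vec.Base as Vec using (Vec; []; _∷_)
open import Data.Product.Base using (Σ; ∃; _×_; _,_; proj₁; proj₂)
open import Data.Sum.Base using (inj₁; inj₂)
open import Relation.Nullary.Decidable using (yes; no)
open import Relation.Nullary.Negation using (contradiction)
open import Relation.Binary.PropositionalEquality

infixl 6 _+ᴿ_
infixl 7 _*ᴿ_ _/ᴿ_ _*ˢ_ _·ˢ_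
infix  8 -ᴿ_ -ˢ_
infixr 9 _^ᴿ_ _^ˢ_
infix  4 _≃_

------------------------------------------------------------------------
-- Real numbers: Cauchy sequences of rationals

Cauchy : (ℕ → ℚ) → Set
Cauchy x = ∀ ε → 0ℚ < ε →
  ∃ λ N → ∀ m n → N ℕ.≤ m → N ℕ.≤ n → ∣ x m - x n ∣ < ε

record ℝ : Set where
  constructor mkℝ
  field
    seq    : ℕ → ℚ
    cauchy : Cauchy seq

open ℝ public

_≃_ : ℝ → ℝ → Set
x ≃ y = ∀ ε → 0ℚ < ε →
  ∃ λ N → ∀ n → N ℕ.≤ n → ∣ seq x n - seq y n ∣ < ε

half-pos : ∀ {ε} → 0ℚ < ε → 0ℚ < ε * ½
half-pos {ε} 0<ε = subst (_< ε * ½) (*-zeroˡ ½) (*-monoˡ-<-pos ½ 0<ε)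

halves : ∀ ε → ε * ½ + ε * ½ ≡ ε
halves ε = trans (sym (*-distribˡ-+ ε ½ ½)) (*-identityʳ ε)

p-p≡0 : ∀ p → p - p ≡ 0ℚ
p-p≡0 = +-inverseʳ

*-mono-≤-nonNeg : ∀ {p q r s} → 0ℚ ≤ r → 0ℚ ≤ q →
                  p ≤ q → r ≤ s → p * r ≤ q * s
*-mono-≤-nonNeg {p} {q} {r} {s} 0≤r 0≤q p≤q r≤s = ≤-trans
  (*-monoʳ-≤-nonNeg r {{nonNegative 0≤r}} p≤q)
  (*-monoˡ-≤-nonNeg q {{nonNegative 0≤q}} r≤s)

const-cauchy : ∀ q → Cauchy (λ _ → q)
const-cauchy q ε 0<ε = 0 , λ _ _ _ _ →
  subst (_< ε) (sym (cong ∣_∣ (p-p≡0 q))) 0<ε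

+-cauchy : ∀ x y → Cauchy x → Cauchy y → Cauchy (λ n → x n + y n)
+-cauchy x y cx cy ε 0<ε = M ℕ.⊔ N , λ m n M⊔N≤m M⊔N≤n → begin-strict
    ∣ x m + y m - (x n + y n) ∣       ≡⟨ cong ∣_∣ (regroup (x m) (y m) (x n) (y n)) ⟩
    ∣ (x m - x n) + (y m - y n) ∣     ≤⟨ ∣p+q∣≤∣p∣+∣q∣ (x m - x n) (y m - y n) ⟩
    ∣ x m - x n ∣ + ∣ y m - y n ∣     <⟨ +-mono-<
      (hx m n (ℕ.m⊔n≤o⇒m≤o M N M⊔N≤m) (ℕ.m⊔n≤o⇒m≤o M N M⊔N≤n))
      (hy m n (ℕ.m⊔n≤o⇒n≤o M N M⊔N≤m) (ℕ.m⊔n≤o⇒n≤o M N M⊔N≤n)) ⟩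
    ε * ½ + ε * ½                     ≡⟨ halves ε ⟩
    ε                                 ∎
  where
  open ≤-Reasoning
  open +-*-Solver
  M = proj₁ (cx (ε * ½) (half-pos 0<ε))
  hx = proj₂ (cx (ε * ½) (half-pos 0<ε))
  N = proj₁ (cy (ε * ½) (half-pos 0<ε))
  hy = proj₂ (cy (ε * ½) (half-pos 0<ε))
  regroup : ∀ a b c d → a + b - (c + d) ≡ (a - c) + (b - d)
  regroup = solve 4 (λ a b c d →
    a :+ b :- (c :+ d) := (a :- c) :+ (b :- d)) refl

neg-cauchy : ∀ x → Cauchy x → Cauchy (λ n → - x n)
neg-cauchy x cx ε 0<ε = proj₁ (cx ε 0<ε) , λ m n N≤m N≤n →
  subst (_< ε) (flip (x m) (x n)) (proj₂ (cx ε 0<ε) m n N≤m N≤n)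
  where
  flip : ∀ p q → ∣ p - q ∣ ≡ ∣ - p - - q ∣
  flip p q = trans (sym (∣-p∣≡∣p∣ (p - q))) (cong ∣_∣ (neg-distrib-+ p (- q)))

bounded : ∀ x → Cauchy x →
  ∃ λ B → 0ℚ < B × ∃ λ N → ∀ n → N ℕ.≤ n → ∣ x n ∣ ≤ B
bounded x cx = B , 0<B , N , λ n N≤n → begin
    ∣ x n ∣                    ≡⟨ cong ∣_∣ (split (x n) (x N)) ⟩
    ∣ x N + (x n - x N) ∣      ≤⟨ ∣p+q∣≤∣p∣+∣q∣ (x N) (x n - x N) ⟩
    ∣ x N ∣ + ∣ x n - x N ∣    ≤⟨ +-monoʳ-≤ ∣ x N ∣ (<⇒≤ (h n N N≤n ℕ.≤-refl)) ⟩
    ∣ x N ∣ + 1ℚ               ∎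
  where
  open ≤-Reasoning
  open +-*-Solver
  0<1 : 0ℚ < 1ℚ
  0<1 = positive⁻¹ 1ℚ
  N = proj₁ (cx 1ℚ 0<1)
  h = proj₂ (cx 1ℚ 0<1)
  B = ∣ x N ∣ + 1ℚ
  0<B : 0ℚ < B
  0<B = subst (_< B) (+-identityˡ 0ℚ) (+-mono-≤-< (0≤∣p∣ (x N)) 0<1)
  split : ∀ p q → p ≡ q + (p - q)
  split = solve 2 (λ p q → p := q :+ (p :- q)) refl

quotient : ∀ ε B → 0ℚ < ε → 0ℚ < B → ∃ λ δ → 0ℚ < δ × B * δ ≡ ε
quotient ε B 0<ε 0<B = δ , 0<δ , Bδ≡ε
  where
  instance
    B-pos : Positive B
    B-pos = positive 0<B
    ε-pos : Positive ε
    ε-pos = positive 0<ε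
    B-nonZero = pos⇒nonZero B
    1/B-pos : Positive (1/ B)
    1/B-pos = 1/pos⇒pos B
  δ = 1/ B * ε
  0<δ : 0ℚ < δ
  0<δ = positive⁻¹ δ {{pos*pos⇒pos (1/ B) ε}}
  Bδ≡ε : B * δ ≡ ε
  Bδ≡ε = trans (sym (*-assoc B (1/ B) ε))
           (trans (cong (_* ε) (*-inverseʳ B)) (*-identityˡ ε))

*-small : ∀ {p q B δ ε} → 0ℚ < B → ∣ p ∣ ≤ B → ∣ q ∣ < δ → B * δ ≡ ε →
          ∣ p ∣ * ∣ q ∣ < ε
*-small {p} {q} {B} {δ} {ε} 0<B p≤B q<δ Bδ≡ε = begin-strict
    ∣ p ∣ * ∣ q ∣ ≤⟨ *-monoʳ-≤-nonNeg ∣ q ∣ {{∣-∣-nonNeg q}} p≤B ⟩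
    B * ∣ q ∣     <⟨ *-monoʳ-<-pos B {{positive 0<B}} q<δ ⟩
    B * δ         ≡⟨ Bδ≡ε ⟩
    ε             ∎
  where open ≤-Reasoning

*-cauchy : ∀ x y → Cauchy x → Cauchy y → Cauchy (λ n → x n * y n)
*-cauchy x y cx cy ε 0<ε =
  let B , 0<B , Nx , x≤B = bounded x cx
      C , 0<C , Ny , y≤C = bounded y cy
      δ , 0<δ , Bδ≡ = quotient (ε * ½) B (half-pos 0<ε) 0<B
      η , 0<η , Cη≡ = quotient (ε * ½) C (half-pos 0<ε) 0<C
      N₁ , hy = cy δ 0<δ
      N₂ , hx = cx η 0<η
  in (Nx ℕ.⊔ Ny) ℕ.⊔ (N₁ ℕ.⊔ N₂) , λ m n ≤m ≤n →
    let xy≤m  = ℕ.m⊔n≤o⇒m≤o (Nx ℕ.⊔ Ny) (N₁ ℕ.⊔ N₂) ≤m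
        xy≤n  = ℕ.m⊔n≤o⇒m≤o (Nx ℕ.⊔ Ny) (N₁ ℕ.⊔ N₂) ≤n
        N₁₂≤m = ℕ.m⊔n≤o⇒n≤o (Nx ℕ.⊔ Ny) (N₁ ℕ.⊔ N₂) ≤m
        N₁₂≤n = ℕ.m⊔n≤o⇒n≤o (Nx ℕ.⊔ Ny) (N₁ ℕ.⊔ N₂) ≤n
    in close m n
      (*-small {x m} {y m - y n} 0<B (x≤B m (ℕ.m⊔n≤o⇒m≤o Nx Ny xy≤m))
        (hy m n (ℕ.m⊔n≤o⇒m≤o N₁ N₂ N₁₂≤m) (ℕ.m⊔n≤o⇒m≤o N₁ N₂ N₁₂≤n)) Bδ≡)
      (*-small {y n} {x m - x n} 0<C (y≤C n (ℕ.m⊔n≤o⇒n≤o Nx Ny xy≤n))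
        (hx m n (ℕ.m⊔n≤o⇒n≤o N₁ N₂ N₁₂≤m) (ℕ.m⊔n≤o⇒n≤o N₁ N₂ N₁₂≤n)) Cη≡)
  where
  open ≤-Reasoning
  open +-*-Solver
  regroup : ∀ a b c d → a * b - c * d ≡ a * (b - d) + d * (a - c)
  regroup = solve 4 (λ a b c d →
    a :* b :- c :* d := a :* (b :- d) :+ d :* (a :- c)) refl
  close : ∀ m n → ∣ x m ∣ * ∣ y m - y n ∣ < ε * ½ →
          ∣ y n ∣ * ∣ x m - x n ∣ < ε * ½ → ∣ x m * y m - x n * y n ∣ < ε
  close m n h₁ h₂ = begin-strict
    ∣ x m * y m - x n * y n ∣
      ≡⟨ cong ∣_∣ (regroup (x m) (y m) (x n) (y n)) ⟩
    ∣ x m * (y m - y n) + y n * (x m - x n) ∣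
      ≤⟨ ∣p+q∣≤∣p∣+∣q∣ (x m * (y m - y n)) (y n * (x m - x n)) ⟩
    ∣ x m * (y m - y n) ∣ + ∣ y n * (x m - x n) ∣
      ≡⟨ cong₂ _+_ (∣p*q∣≡∣p∣*∣q∣ (x m) (y m - y n))
                   (∣p*q∣≡∣p∣*∣q∣ (y n) (x m - x n)) ⟩
    ∣ x m ∣ * ∣ y m - y n ∣ + ∣ y n ∣ * ∣ x m - x n ∣
      <⟨ +-mono-< h₁ h₂ ⟩
    ε * ½ + ε * ½
      ≡⟨ halves ε ⟩
    ε ∎

-- The moduli of convergence do not affect values; unfolding them would only
-- slow down conversion checking.
abstract

  fromℚ-cauchy : ∀ q → Cauchy (λ _ → q)
  fromℚ-cauchy = const-cauchy

  +ᴿ-cauchy : ∀ x y → Cauchy (λ n → seq x n + seq y n)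
  +ᴿ-cauchy x y = +-cauchy (seq x) (seq y) (cauchy x) (cauchy y)

  *ᴿ-cauchy : ∀ x y → Cauchy (λ n → seq x n * seq y n)
  *ᴿ-cauchy x y = *-cauchy (seq x) (seq y) (cauchy x) (cauchy y)

  -ᴿ-cauchy : ∀ x → Cauchy (λ n → - seq x n)
  -ᴿ-cauchy x = neg-cauchy (seq x) (cauchy x)

fromℚ : ℚ → ℝ
fromℚ q = mkℝ (λ _ → q) (fromℚ-cauchy q)

0ᴿ 1ᴿ : ℝ
0ᴿ = fromℚ 0ℚ
1ᴿ = fromℚ 1ℚ

_+ᴿ_ : ℝ → ℝ → ℝ
x +ᴿ y = mkℝ (λ n → seq x n + seq y n) (+ᴿ-cauchy x y)

_*ᴿ_ : ℝ → ℝ → ℝ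
x *ᴿ y = mkℝ (λ n → seq x n * seq y n) (*ᴿ-cauchy x y)

-ᴿ_ : ℝ → ℝ
-ᴿ x = mkℝ (λ n → - seq x n) (-ᴿ-cauchy x)

_/ᴿ_ : ℝ → (m : ℕ) .{{_ : NonZero m}} → ℝ
x /ᴿ m = x *ᴿ fromℚ (+ 1 / m)

_^ᴿ_ : ℝ → ℕ → ℝ
x ^ᴿ zero  = 1ᴿ
x ^ᴿ suc m = x *ᴿ x ^ᴿ m

-- ∑≤ N x = x 0 + x 1 + ⋯ + x N
∑≤ : ℕ → (ℕ → ℝ) → ℝ
∑≤ zero    x = x 0
∑≤ (suc N) x = ∑≤ N x +ᴿ x (suc N)

sumᴿ productᴿ : List ℝ → ℝ
sumᴿ     = foldr _+ᴿ_ 0ᴿ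
productᴿ = foldr _*ᴿ_ 1ᴿ

≃0-refl : 0ᴿ ≃ 0ᴿ
≃0-refl ε 0<ε = 0 , λ _ _ → 0<ε

∣p-0∣ : ∀ p → ∣ p - 0ℚ ∣ ≡ ∣ p ∣
∣p-0∣ p = cong ∣_∣ (+-identityʳ p)

≃0⇒small : ∀ x → x ≃ 0ᴿ → ∀ ε → 0ℚ < ε → ∃ λ N → ∀ n → N ℕ.≤ n → ∣ seq x n ∣ < ε
≃0⇒small x x≃0 ε 0<ε = proj₁ (x≃0 ε 0<ε) , λ n ≤n →
  subst (_< ε) (∣p-0∣ (seq x n)) (proj₂ (x≃0 ε 0<ε) n ≤n)

small⇒≃0 : ∀ x → (∀ ε → 0ℚ < ε → ∃ λ N → ∀ n → N ℕ.≤ n → ∣ seq x n ∣ < ε) → x ≃ 0ᴿ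
small⇒≃0 x small ε 0<ε = proj₁ (small ε 0<ε) , λ n ≤n →
  subst (_< ε) (sym (∣p-0∣ (seq x n))) (proj₂ (small ε 0<ε) n ≤n)

+≃0 : ∀ x y → x ≃ 0ᴿ → y ≃ 0ᴿ → x +ᴿ y ≃ 0ᴿ
+≃0 x y x≃0 y≃0 = small⇒≃0 (x +ᴿ y) λ ε 0<ε →
  let M , hx = ≃0⇒small x x≃0 (ε * ½) (half-pos 0<ε)
      N , hy = ≃0⇒small y y≃0 (ε * ½) (half-pos 0<ε)
  in M ℕ.⊔ N , λ n ≤n → ≤-<-trans (∣p+q∣≤∣p∣+∣q∣ (seq x n) (seq y n))
    (subst (∣ seq x n ∣ + ∣ seq y n ∣ <_) (halves ε)
      (+-mono-< (hx n (ℕ.m⊔n≤o⇒m≤o M N ≤n)) (hy n (ℕ.m⊔n≤o⇒n≤o M N ≤n))))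

-≃0 : ∀ x → x ≃ 0ᴿ → -ᴿ x ≃ 0ᴿ
-≃0 x x≃0 = small⇒≃0 (-ᴿ x) λ ε 0<ε →
  let N , h = ≃0⇒small x x≃0 ε 0<ε
  in N , λ n ≤n → subst (_< ε) (sym (∣-p∣≡∣p∣ (seq x n))) (h n ≤n)

*≃0ʳ : ∀ x y → y ≃ 0ᴿ → x *ᴿ y ≃ 0ᴿ
*≃0ʳ x y y≃0 = small⇒≃0 (x *ᴿ y) λ ε 0<ε →
  let B , 0<B , Nx , x≤B = bounded (seq x) (cauchy x)
      δ , 0<δ , Bδ≡ε = quotient ε B 0<ε 0<B
      Ny , hy = ≃0⇒small y y≃0 δ 0<δ
  in Nx ℕ.⊔ Ny , λ n ≤n → subst (_< ε) (sym (∣p*q∣≡∣p∣*∣q∣ (seq x n) (seq y n)))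
    (*-small {seq x n} {seq y n} 0<B
      (x≤B n (ℕ.m⊔n≤o⇒m≤o Nx Ny ≤n)) (hy n (ℕ.m⊔n≤o⇒n≤o Nx Ny ≤n)) Bδ≡ε)

*≃0ˡ : ∀ x y → x ≃ 0ᴿ → x *ᴿ y ≃ 0ᴿ
*≃0ˡ x y x≃0 = small⇒≃0 (x *ᴿ y) λ ε 0<ε →
  let N , h = ≃0⇒small (y *ᴿ x) (*≃0ʳ y x x≃0) ε 0<ε
  in N , λ n ≤n → subst (λ p → ∣ p ∣ < ε) (*-comm (seq y n) (seq x n)) (h n ≤n)

∑≃0 : ∀ N x → (∀ i → i ℕ.≤ N → x i ≃ 0ᴿ) → ∑≤ N x ≃ 0ᴿ
∑≃0 zero    x h = h 0 ℕ.z≤n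
∑≃0 (suc N) x h = +≃0 (∑≤ N x) (x (suc N))
  (∑≃0 N x (λ i i≤N → h i (ℕ.m≤n⇒m≤1+n i≤N))) (h (suc N) ℕ.≤-refl)

------------------------------------------------------------------------
-- Formal power series over ℝ

PowerSeries : Set
PowerSeries = ℕ → ℝ

[z^_]_ : ℕ → PowerSeries → ℝ
[z^ N ] f = f N

-ˢ_ : PowerSeries → PowerSeries
(-ˢ f) N = -ᴿ f N

_·ˢ_ : ℝ → PowerSeries → PowerSeries
(x ·ˢ f) N = x *ᴿ f N

_*ˢ_ : PowerSeries → PowerSeries → PowerSeries
(f *ˢ g) N = ∑≤ N λ i → f i *ᴿ g (N ℕ.∸ i)

-- monomial x e is x z^e
monomial : ℝ → ℕ → PowerSeries
monomial x e N with N ℕ.≟ e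
... | yes _ = x
... | no  _ = 0ᴿ

_^ˢ_ : PowerSeries → ℕ → PowerSeries
f ^ˢ zero  = monomial 1ᴿ 0
f ^ˢ suc m = f *ˢ f ^ˢ m

Order≥ : ℕ → PowerSeries → Set
Order≥ m f = ∀ i → i ℕ.< m → f i ≃ 0ᴿ

-- The sum of F 0, F 1, F 2, …: as F m is divisible by z^m, only the terms
-- with m ≤ N contribute to the coefficient of z^N.
∑∞ : (F : ℕ → PowerSeries) → (∀ m → Order≥ m (F m)) → PowerSeries
∑∞ F _ N = ∑≤ N λ m → F m N

·-order : ∀ x f m → Order≥ m f → Order≥ m (x ·ˢ f)
·-order x f m f≥m i i<m = *≃0ʳ x (f i) (f≥m i i<m)

^-order : ∀ f → f 0 ≃ 0ᴿ → ∀ m → Order≥ m (f ^ˢ m)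
^-order f f₀≃0 zero    i ()
^-order f f₀≃0 (suc m) i (ℕ.s≤s i≤m) = ∑≃0 i _ term≃0
  where
  term≃0 : ∀ a → a ℕ.≤ i → f a *ᴿ (f ^ˢ m) (i ℕ.∸ a) ≃ 0ᴿ
  term≃0 zero    _   = *≃0ˡ (f 0) ((f ^ˢ m) i) f₀≃0
  term≃0 (suc a) a<i = *≃0ʳ (f (suc a)) ((f ^ˢ m) (i ℕ.∸ suc a))
    (^-order f f₀≃0 m (i ℕ.∸ suc a)
      (ℕ.<-≤-trans (ℕ.∸-monoʳ-< {i} {suc a} {0} ℕ.z<s a<i) i≤m))

exp : (f : PowerSeries) → [z^ 0 ] f ≃ 0ᴿ → PowerSeries
exp f f₀≃0 = ∑∞ (λ m → (1ᴿ /ᴿ m !) {{m ℕ.!≢0}} ·ˢ (f ^ˢ m))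
  (λ m → ·-order ((1ᴿ /ᴿ m !) {{m ℕ.!≢0}}) (f ^ˢ m) m (^-order f f₀≃0 m))

monomial-order : ∀ x e → Order≥ e (monomial x e)
monomial-order x e i i<e with i ℕ.≟ e
... | yes i≡e = contradiction i≡e (ℕ.<⇒≢ i<e)
... | no  _   = ≃0-refl

module _ (n : ℕ) .{{_ : NonZero n}} (a : (j : ℕ) → .{{NonZero j}} → ℝ) where

  ∑ⱼ-order : ∀ i → Order≥ (suc i) (monomial (a (suc i)) (n ℕ.* suc i))
  ∑ⱼ-order i m m≤i = monomial-order (a (suc i)) (n ℕ.* suc i) m
    (ℕ.<-≤-trans m≤i (ℕ.m≤n*m (suc i) n))

  -- Σ_{j ≥ 1} a j z^{nj}, indexed by i = j - 1
  ∑ⱼ : PowerSeries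
  ∑ⱼ = ∑∞ (λ i → monomial (a (suc i)) (n ℕ.* suc i))
    (λ i m m<i → ∑ⱼ-order i m (ℕ.m<n⇒m<1+n m<i))

  -∑ⱼ-constantTerm : [z^ 0 ] (-ˢ ∑ⱼ) ≃ 0ᴿ
  -∑ⱼ-constantTerm = -≃0 ([z^ 0 ] ∑ⱼ) (∑ⱼ-order 0 0 ℕ.z<s)

------------------------------------------------------------------------
-- Zeta values

-- Only evaluated at positive arguments below.
recip : ℕ → ℚ
recip zero    = 0ℚ
recip (suc m) = + 1 / suc m

sumℚ : List ℚ → ℚ
sumℚ = foldr _+_ 0ℚ

-- zetaPartial s N = Σ_{1 ≤ m ≤ N} 1 / m^s
zetaPartial : ℕ → ℕ → ℚ
zetaPartial s zero    = 0ℚ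
zetaPartial s (suc N) = zetaPartial s N + recip (suc N ℕ.^ s)

-- The tuples (n₁ , … , n_k) with N ≥ n₁ > n₂ > ⋯ > n_k ≥ 1: if N ≥ 1, then
-- either n₁ = N or n₁ ≤ N - 1.
decreasing : ∀ k → ℕ → List (Vec ℕ k)
decreasing zero    N       = [] ∷ []
decreasing (suc k) zero    = []
decreasing (suc k) (suc N) =
  map (suc N ∷_) (decreasing k N) ++ decreasing (suc k) N

productᵥ : ∀ {k} → Vec ℕ k → ℕ
productᵥ = Vec.foldr _ ℕ._*_ 1

mzvTerm : ∀ n {k} → Vec ℕ k → ℚ
mzvTerm n v = recip (productᵥ v ℕ.^ n)

mzvPartial : ℕ → ℕ → ℕ → ℚ
mzvPartial n k N = sumℚ (map (mzvTerm n) (decreasing k N))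

fromℕ : ℕ → ℚ
fromℕ K = + K / 1

0≤recip : ∀ m → 0ℚ ≤ recip m
0≤recip zero    = ≤-refl
0≤recip (suc m) = nonNegative⁻¹ (recip (suc m)) {{normalize-nonNeg 1 (suc m)}}

0≤fromℕ : ∀ K → 0ℚ ≤ fromℕ K
0≤fromℕ K = nonNegative⁻¹ (fromℕ K) {{normalize-nonNeg K 1}}

recip-mul : ∀ m → recip (suc m) * fromℕ (suc m) ≡ 1ℚ
recip-mul m = toℚᵘ-injective (begin
    toℚᵘ (recip (suc m) * fromℕ (suc m))
      ≈⟨ toℚᵘ-homo-* (recip (suc m)) (fromℕ (suc m)) ⟩
    toℚᵘ (recip (suc m)) ℚᵘ.* toℚᵘ (fromℕ (suc m))
      ≈⟨ ℚᵘ.*-cong (toℚᵘ-fromℚᵘ (mkℚᵘ (+ 1) m)) (toℚᵘ-fromℚᵘ (mkℚᵘ (+ suc m) 0)) ⟩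
    mkℚᵘ (+ 1) m ℚᵘ.* mkℚᵘ (+ suc m) 0
      ≈⟨ ℚᵘ.*≡* (cong +_ (cross m)) ⟩
    toℚᵘ 1ℚ ∎)
  where
  open ℚᵘ.≃-Reasoning
  cross : ∀ m → (1 ℕ.* suc m) ℕ.* 1 ≡ 1 ℕ.* (suc m ℕ.* 1)
  cross m = ℕ.*-assoc 1 (suc m) 1

fromℕ-+ : ∀ a b → fromℕ (a ℕ.+ b) ≡ fromℕ a + fromℕ b
fromℕ-+ a b = toℚᵘ-injective (begin
    toℚᵘ (fromℕ (a ℕ.+ b))
      ≈⟨ toℚᵘ-fromℚᵘ (mkℚᵘ (+ (a ℕ.+ b)) 0) ⟩
    mkℚᵘ (+ (a ℕ.+ b)) 0
      ≈⟨ ℚᵘ.*≡* (cong (ℤ._* + 1) (sym (cong₂ ℤ._+_ (ℤ.*-identityʳ (+ a)) (ℤ.*-identityʳ (+ b))))) ⟩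
    mkℚᵘ (+ a) 0 ℚᵘ.+ mkℚᵘ (+ b) 0
      ≈⟨ ℚᵘ.+-cong (toℚᵘ-fromℚᵘ (mkℚᵘ (+ a) 0)) (toℚᵘ-fromℚᵘ (mkℚᵘ (+ b) 0)) ⟨
    toℚᵘ (fromℕ a) ℚᵘ.+ toℚᵘ (fromℕ b)
      ≈⟨ toℚᵘ-homo-+ (fromℕ a) (fromℕ b) ⟨
    toℚᵘ (fromℕ a + fromℕ b) ∎)
  where open ℚᵘ.≃-Reasoning

fromℕ-* : ∀ a b → fromℕ (a ℕ.* b) ≡ fromℕ a * fromℕ b
fromℕ-* a b = toℚᵘ-injective (begin
    toℚᵘ (fromℕ (a ℕ.* b))
      ≈⟨ toℚᵘ-fromℚᵘ (mkℚᵘ (+ (a ℕ.* b)) 0) ⟩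
    mkℚᵘ (+ (a ℕ.* b)) 0
      ≈⟨ ℚᵘ.*≡* (cong (ℤ._* + 1) (ℤ.pos-* a b)) ⟩
    mkℚᵘ (+ a) 0 ℚᵘ.* mkℚᵘ (+ b) 0
      ≈⟨ ℚᵘ.*-cong (toℚᵘ-fromℚᵘ (mkℚᵘ (+ a) 0)) (toℚᵘ-fromℚᵘ (mkℚᵘ (+ b) 0)) ⟨
    toℚᵘ (fromℕ a) ℚᵘ.* toℚᵘ (fromℕ b)
      ≈⟨ toℚᵘ-homo-* (fromℕ a) (fromℕ b) ⟨
    toℚᵘ (fromℕ a * fromℕ b) ∎)
  where open ℚᵘ.≃-Reasoning

fromℕ-mono : ∀ {a b} → a ℕ.≤ b → fromℕ a ≤ fromℕ b
fromℕ-mono {a} {b} a≤b = subst (fromℕ a ≤_)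
  (trans (sym (fromℕ-+ a (b ℕ.∸ a))) (cong fromℕ (ℕ.m+[n∸m]≡n a≤b)))
  (subst (_≤ fromℕ a + fromℕ (b ℕ.∸ a)) (+-identityʳ (fromℕ a))
    (+-monoʳ-≤ (fromℕ a) (0≤fromℕ (b ℕ.∸ a))))

inverse-unique : ∀ p q a → p * a ≡ 1ℚ → q * a ≡ 1ℚ → p ≡ q
inverse-unique p q a pa qa = begin
    p              ≡⟨ *-identityʳ p ⟨
    p * 1ℚ         ≡⟨ cong (p *_) qa ⟨
    p * (q * a)    ≡⟨ swap p q a ⟩
    q * (p * a)    ≡⟨ cong (q *_) pa ⟩
    q * 1ℚ         ≡⟨ *-identityʳ q ⟩
    q              ∎
  where
  open ≡-Reasoning
  open +-*-Solver
  swap : ∀ p q a → p * (q * a) ≡ q * (p * a)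
  swap = solve 3 (λ p q a → p :* (q :* a) := q :* (p :* a)) refl

recip-* : ∀ a b → recip (a ℕ.* b) ≡ recip a * recip b
recip-* zero    b       = sym (*-zeroˡ (recip b))
recip-* (suc a) zero    = trans (cong recip (ℕ.*-zeroʳ a)) (sym (*-zeroʳ (recip (suc a))))
recip-* (suc a) (suc b) = inverse-unique _ _ (fromℕ (suc a ℕ.* suc b))
  (recip-mul (b ℕ.+ a ℕ.* suc b)) (begin
    recip (suc a) * recip (suc b) * fromℕ (suc a ℕ.* suc b)
      ≡⟨ cong (recip (suc a) * recip (suc b) *_) (fromℕ-* (suc a) (suc b)) ⟩
    recip (suc a) * recip (suc b) * (fromℕ (suc a) * fromℕ (suc b))
      ≡⟨ swap (recip (suc a)) (recip (suc b)) (fromℕ (suc a)) (fromℕ (suc b)) ⟩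
    (recip (suc a) * fromℕ (suc a)) * (recip (suc b) * fromℕ (suc b))
      ≡⟨ cong₂ _*_ (recip-mul a) (recip-mul b) ⟩
    1ℚ ∎)
  where
  open ≡-Reasoning
  open +-*-Solver
  swap : ∀ p q a b → p * q * (a * b) ≡ (p * a) * (q * b)
  swap = solve 4 (λ p q a b → p :* q :* (a :* b) := (p :* a) :* (q :* b)) refl

recip-antimono : ∀ {a b} → a ℕ.≤ b → recip (suc b) ≤ recip (suc a)
recip-antimono {a} {b} a≤b = begin
    y             ≡⟨ *-identityʳ y ⟨
    y * 1ℚ        ≡⟨ cong (y *_) (recip-mul a) ⟨
    y * (x * fromℕ (suc a))
                  ≤⟨ *-monoˡ-≤-nonNeg y {{nonNegative (0≤recip (suc b))}}
                       (*-monoˡ-≤-nonNeg x {{nonNegative (0≤recip (suc a))}}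
                         (fromℕ-mono (ℕ.s≤s a≤b))) ⟩
    y * (x * fromℕ (suc b))
                  ≡⟨ swap y x (fromℕ (suc b)) ⟩
    x * (y * fromℕ (suc b))
                  ≡⟨ cong (x *_) (recip-mul b) ⟩
    x * 1ℚ        ≡⟨ *-identityʳ x ⟩
    x             ∎
  where
  open ≤-Reasoning
  open +-*-Solver
  x = recip (suc a)
  y = recip (suc b)
  swap : ∀ p q a → p * (q * a) ≡ q * (p * a)
  swap = solve 3 (λ p q a → p :* (q :* a) := q :* (p :* a)) refl

recip-antimono′ : ∀ {a b} .{{_ : NonZero a}} → a ℕ.≤ b → recip b ≤ recip a
recip-antimono′ {suc a} {suc b} (ℕ.s≤s a≤b) = recip-antimono a≤b

recip-telescope : ∀ N →
  recip (suc N) ≡ recip (suc (suc N)) + recip (suc N) * recip (suc (suc N))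
recip-telescope N = begin
    x                          ≡⟨ *-identityʳ x ⟨
    x * 1ℚ                     ≡⟨ cong (x *_) (recip-mul (suc N)) ⟨
    x * (y * fromℕ (1 ℕ.+ suc N))
                               ≡⟨ cong (λ t → x * (y * t)) (fromℕ-+ 1 (suc N)) ⟩
    x * (y * (1ℚ + a))         ≡⟨ swap x y a ⟩
    y * (x * a) + x * y        ≡⟨ cong (λ t → y * t + x * y) (recip-mul N) ⟩
    y * 1ℚ + x * y             ≡⟨ cong (_+ x * y) (*-identityʳ y) ⟩
    y + x * y                  ∎
  where
  open ≡-Reasoning
  open +-*-Solver
  x = recip (suc N)
  y = recip (suc (suc N))
  a = fromℕ (suc N)
  swap : ∀ x y a → x * (y * (1ℚ + a)) ≡ y * (x * a) + x * y
  swap = solve 3 (λ x y a →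
    x :* (y :* (con 1ℚ :+ a)) := y :* (x :* a) :+ x :* y) refl

-- 1 / (N+1)² + 2 / (N+2) ≤ 2 / (N+1)
square-step : ∀ N → recip (suc N) * recip (suc N) + fromℕ 2 * recip (suc (suc N))
                    ≤ fromℕ 2 * recip (suc N)
square-step N = begin
    x * x + fromℕ 2 * y
      ≤⟨ +-monoˡ-≤ (fromℕ 2 * y)
           (*-monoˡ-≤-nonNeg x {{nonNegative (0≤recip (suc N))}} x≤2y) ⟩
    x * (fromℕ 2 * y) + fromℕ 2 * y
      ≡⟨ swap x y (fromℕ 2) ⟩
    fromℕ 2 * (y + x * y)
      ≡⟨ cong (fromℕ 2 *_) (recip-telescope N) ⟨
    fromℕ 2 * x ∎
  where
  open ≤-Reasoning
  open +-*-Solver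
  x = recip (suc N)
  y = recip (suc (suc N))
  swap : ∀ x y c → x * (c * y) + c * y ≡ c * (y + x * y)
  swap = solve 3 (λ x y c → x :* (c :* y) :+ c :* y := c :* (y :+ x :* y)) refl
  cancel : ∀ x → fromℕ 2 * (recip 2 * x) ≡ x
  cancel x = trans (sym (*-assoc (fromℕ 2) (recip 2) x)) (*-identityˡ x)
  2+N≤2[1+N] : suc (suc N) ℕ.≤ 2 ℕ.* suc N
  2+N≤2[1+N] = ℕ.s≤s (ℕ.≤-trans (ℕ.≤-reflexive (ℕ.+-comm 1 N))
    (ℕ.+-monoʳ-≤ N (ℕ.s≤s ℕ.z≤n)))
  x≤2y : x ≤ fromℕ 2 * y
  x≤2y = subst (_≤ fromℕ 2 * y)
    (trans (cong (fromℕ 2 *_) (recip-* 2 (suc N))) (cancel x))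
    (*-monoˡ-≤-nonNeg (fromℕ 2) (recip-antimono′ 2+N≤2[1+N]))

archimedean : ∀ K ε → 0ℚ < ε → ∃ λ N → fromℕ K * recip (suc N) < ε
archimedean K ε@(mkℚ (+ zero) d c) 0<ε =
  contradiction (positive 0<ε) λ ()
archimedean K ε@(mkℚ (ℤ.-[1+ _ ]) d c) 0<ε =
  contradiction (positive 0<ε) λ ()
archimedean K ε@(mkℚ (+ suc p) d c) 0<ε = N , toℚᵘ-cancel-< (begin-strict
    toℚᵘ (fromℕ K * recip (suc N))
      ≃⟨ toℚᵘ-homo-* (fromℕ K) (recip (suc N)) ⟩
    toℚᵘ (fromℕ K) ℚᵘ.* toℚᵘ (recip (suc N))
      ≃⟨ ℚᵘ.*-cong (toℚᵘ-fromℚᵘ (mkℚᵘ (+ K) 0)) (toℚᵘ-fromℚᵘ (mkℚᵘ (+ 1) N)) ⟩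
    mkℚᵘ (+ K) 0 ℚᵘ.* mkℚᵘ (+ 1) N
      <⟨ ℚᵘ.*<* (subst₂ ℤ._<_ left (ℤ.pos-* (suc p) (1 ℕ.* suc N)) (ℤ.+<+ cross)) ⟩
    mkℚᵘ (+ suc p) d ∎)
  where
  open ℚᵘ.≤-Reasoning
  N = K ℕ.* suc d
  left : + (K ℕ.* suc d) ≡ (+ K ℤ.* + 1) ℤ.* + suc d
  left = trans (ℤ.pos-* K (suc d)) (cong (ℤ._* + suc d) (sym (ℤ.*-identityʳ (+ K))))
  cross : K ℕ.* suc d ℕ.< suc p ℕ.* (1 ℕ.* suc N)
  cross = ℕ.<-≤-trans (ℕ.n<1+n N)
    (ℕ.≤-trans (ℕ.≤-reflexive (sym (ℕ.*-identityˡ (suc N))))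
      (ℕ.m≤n*m (1 ℕ.* suc N) (suc p)))

-- Partial sums whose N-th increment lies between 0 and K / N².
record SquareSummable (K : ℕ) (S : ℕ → ℚ) : Set where
  field
    nonNeg₀  : 0ℚ ≤ S 0
    increase : ∀ N → S N ≤ S (suc N)
    bound    : ∀ N →
      S (suc N) ≤ S N + fromℕ K * (recip (suc N) * recip (suc N))

module _ {K S} (summable : SquareSummable K S) where
  open SquareSummable summable

  mono : ∀ {m n} → m ℕ.≤ n → S m ≤ S n
  mono m≤n = go (ℕ.≤⇒≤′ m≤n)
    where
    go : ∀ {m n} → m ℕ.≤′ n → S m ≤ S n
    go (ℕ.≤′-reflexive refl) = ≤-refl
    go (ℕ.≤′-step m≤n)       = ≤-trans (go m≤n) (increase _)

  tail : ℕ → ℚ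
  tail N = fromℕ K * (fromℕ 2 * recip (suc N))

  0≤tail : ∀ N → 0ℚ ≤ tail N
  0≤tail N = subst (_≤ tail N) (*-zeroʳ (fromℕ K)) (*-monoˡ-≤-nonNeg (fromℕ K)
    {{nonNegative (0≤fromℕ K)}} (subst (_≤ fromℕ 2 * recip (suc N)) (*-zeroʳ (fromℕ 2))
      (*-monoˡ-≤-nonNeg (fromℕ 2) (0≤recip (suc N)))))

  potential-step : ∀ N → S (suc N) + tail (suc N) ≤ S N + tail N
  potential-step N = begin
      S (suc N) + tail (suc N)
        ≤⟨ +-monoˡ-≤ (tail (suc N)) (bound N) ⟩
      S N + fromℕ K * (x * x) + fromℕ K * (fromℕ 2 * y)
        ≡⟨ regroup (S N) (fromℕ K) (x * x) (fromℕ 2 * y) ⟩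
      S N + fromℕ K * (x * x + fromℕ 2 * y)
        ≤⟨ +-monoʳ-≤ (S N) (*-monoˡ-≤-nonNeg (fromℕ K)
             {{nonNegative (0≤fromℕ K)}} (square-step N)) ⟩
      S N + tail N ∎
    where
    open ≤-Reasoning
    open +-*-Solver
    x = recip (suc N)
    y = recip (suc (suc N))
    regroup : ∀ s k a b → s + k * a + k * b ≡ s + k * (a + b)
    regroup = solve 4 (λ s k a b → s :+ k :* a :+ k :* b := s :+ k :* (a :+ b)) refl

  potential : ∀ {m n} → m ℕ.≤ n → S n + tail n ≤ S m + tail m
  potential m≤n = go (ℕ.≤⇒≤′ m≤n)
    where
    go : ∀ {m n} → m ℕ.≤′ n → S n + tail n ≤ S m + tail m
    go (ℕ.≤′-reflexive refl) = ≤-refl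
    go (ℕ.≤′-step m≤n)       = ≤-trans (potential-step _) (go m≤n)

  remainder : ∀ {m n} → m ℕ.≤ n → S n ≤ S m + tail m
  remainder {m} {n} m≤n = ≤-trans
    (subst (_≤ S n + tail n) (+-identityʳ (S n)) (+-monoʳ-≤ (S n) (0≤tail n)))
    (potential m≤n)

  S-nonNeg : ∀ N → 0ℚ ≤ S N
  S-nonNeg N = ≤-trans nonNeg₀ (mono ℕ.z≤n)

  distance : ∀ {m n} → m ℕ.≤ n → ∣ S n - S m ∣ ≤ tail m
  distance {m} {n} m≤n = begin
      ∣ S n - S m ∣            ≡⟨ 0≤p⇒∣p∣≡p 0≤diff ⟩
      S n - S m                ≤⟨ +-monoˡ-≤ (- S m) (remainder m≤n) ⟩
      S m + tail m - S m       ≡⟨ cancel (S m) (tail m) ⟩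
      tail m                   ∎
    where
    open ≤-Reasoning
    open +-*-Solver
    0≤diff : 0ℚ ≤ S n - S m
    0≤diff = subst (_≤ S n - S m) (p-p≡0 (S m)) (+-monoˡ-≤ (- S m) (mono m≤n))
    cancel : ∀ s t → s + t - s ≡ t
    cancel = solve 2 (λ s t → s :+ t :- s := t) refl

  tail-antimono : ∀ {m n} → m ℕ.≤ n → tail n ≤ tail m
  tail-antimono m≤n = *-monoˡ-≤-nonNeg (fromℕ K) {{nonNegative (0≤fromℕ K)}}
    (*-monoˡ-≤-nonNeg (fromℕ 2) (recip-antimono m≤n))

  summable⇒cauchy : Cauchy S
  summable⇒cauchy ε 0<ε with archimedean (K ℕ.* 2) ε 0<ε
  ... | N , h = N , close
    where
    tail<ε : tail N < ε
    tail<ε = subst (_< ε) (trans (cong (_* recip (suc N)) (fromℕ-* K 2))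
      (*-assoc (fromℕ K) (fromℕ 2) (recip (suc N)))) h
    swap : ∀ p q → ∣ p - q ∣ ≡ ∣ q - p ∣
    swap p q = trans (sym (∣-p∣≡∣p∣ (p - q))) (cong ∣_∣ (neg-diff p q))
      where
      open +-*-Solver
      neg-diff : ∀ p q → - (p - q) ≡ q - p
      neg-diff = solve 2 (λ p q → :- (p :- q) := q :- p) refl
    close : ∀ m n → N ℕ.≤ m → N ℕ.≤ n → ∣ S m - S n ∣ < ε
    close m n N≤m N≤n with ℕ.≤-total m n
    ... | inj₁ m≤n = ≤-<-trans (subst (_≤ tail m) (swap (S n) (S m)) (distance m≤n))
                       (≤-<-trans (tail-antimono N≤m) tail<ε)
    ... | inj₂ n≤m = ≤-<-trans (distance n≤m) (≤-<-trans (tail-antimono N≤n) tail<ε)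

recip-power : ∀ N s → .{{NonTrivial s}} →
  recip (suc N ℕ.^ s) ≤ recip (suc N) * recip (suc N)
recip-power N s = subst (recip (suc N ℕ.^ s) ≤_)
  (trans (cong recip (cong (suc N ℕ.*_) (ℕ.*-identityʳ (suc N)))) (recip-* (suc N) (suc N)))
  (recip-antimono′ {suc N ℕ.^ 2} (ℕ.^-monoʳ-≤ (suc N) (ℕ.nonTrivial⇒n>1 s)))

p≤p+q : ∀ p {q} → 0ℚ ≤ q → p ≤ p + q
p≤p+q p {q} 0≤q = subst (_≤ p + q) (+-identityʳ p) (+-monoʳ-≤ p 0≤q)

zeta-summable : ∀ s → .{{NonTrivial s}} → SquareSummable 1 (zetaPartial s)
zeta-summable s = record
  { nonNeg₀  = ≤-refl
  ; increase = λ N → p≤p+q (zetaPartial s N) (0≤recip (suc N ℕ.^ s))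
  ; bound    = λ N → +-monoʳ-≤ (zetaPartial s N)
      (subst (recip (suc N ℕ.^ s) ≤_) (sym (*-identityˡ (recip (suc N) * recip (suc N))))
        (recip-power N s))
  }

sumℚ-++ : ∀ xs ys → sumℚ (xs ++ ys) ≡ sumℚ xs + sumℚ ys
sumℚ-++ []       ys = sym (+-identityˡ (sumℚ ys))
sumℚ-++ (x ∷ xs) ys = trans (cong (_+_ x) (sumℚ-++ xs ys))
  (sym (+-assoc x (sumℚ xs) (sumℚ ys)))

^-distribʳ-* : ∀ n a b → (a ℕ.* b) ℕ.^ n ≡ a ℕ.^ n ℕ.* b ℕ.^ n
^-distribʳ-* zero    a b = refl
^-distribʳ-* (suc n) a b = trans (cong (a ℕ.* b ℕ.*_) (^-distribʳ-* n a b))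
  (ℕ.[m*n]*[o*p]≡[m*o]*[n*p] a b (a ℕ.^ n) (b ℕ.^ n))

mzvTerm-∷ : ∀ n {k} m (v : Vec ℕ k) →
  mzvTerm n (m ∷ v) ≡ recip (m ℕ.^ n) * mzvTerm n v
mzvTerm-∷ n m v = trans (cong recip (^-distribʳ-* n m (productᵥ v)))
  (recip-* (m ℕ.^ n) (productᵥ v ℕ.^ n))

sum-mzvTerm-∷ : ∀ n {k} m (vs : List (Vec ℕ k)) →
  sumℚ (map (mzvTerm n) (map (m ∷_) vs)) ≡ recip (m ℕ.^ n) * sumℚ (map (mzvTerm n) vs)
sum-mzvTerm-∷ n m []       = sym (*-zeroʳ (recip (m ℕ.^ n)))
sum-mzvTerm-∷ n m (v ∷ vs) = trans
  (cong₂ _+_ (mzvTerm-∷ n m v) (sum-mzvTerm-∷ n m vs))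
  (sym (*-distribˡ-+ (recip (m ℕ.^ n)) (mzvTerm n v) (sumℚ (map (mzvTerm n) vs))))

mzvPartial-suc : ∀ n k N → mzvPartial n (suc k) (suc N) ≡
  mzvPartial n (suc k) N + recip (suc N ℕ.^ n) * mzvPartial n k N
mzvPartial-suc n k N = begin
    sumℚ (map (mzvTerm n) (map (suc N ∷_) (decreasing k N) ++ decreasing (suc k) N))
      ≡⟨ cong sumℚ (map-++ (mzvTerm n) (map (suc N ∷_) (decreasing k N)) (decreasing (suc k) N)) ⟩
    sumℚ (map (mzvTerm n) (map (suc N ∷_) (decreasing k N)) ++ map (mzvTerm n) (decreasing (suc k) N))
      ≡⟨ sumℚ-++ (map (mzvTerm n) (map (suc N ∷_) (decreasing k N))) _ ⟩
    sumℚ (map (mzvTerm n) (map (suc N ∷_) (decreasing k N))) + mzvPartial n (suc k) N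
      ≡⟨ cong (_+ mzvPartial n (suc k) N) (sum-mzvTerm-∷ n (suc N) (decreasing k N)) ⟩
    recip (suc N ℕ.^ n) * mzvPartial n k N + mzvPartial n (suc k) N
      ≡⟨ +-comm (recip (suc N ℕ.^ n) * mzvPartial n k N) _ ⟩
    mzvPartial n (suc k) N + recip (suc N ℕ.^ n) * mzvPartial n k N ∎
  where open ≡-Reasoning

0≤recip² : ∀ N → 0ℚ ≤ recip (suc N) * recip (suc N)
0≤recip² N = subst (_≤ recip (suc N) * recip (suc N)) (*-zeroʳ (recip (suc N)))
  (*-monoˡ-≤-nonNeg (recip (suc N)) {{nonNegative (0≤recip (suc N))}} (0≤recip (suc N)))

mzv-step : ∀ n k K → .{{NonTrivial n}} →
  SquareSummable K (mzvPartial n k) → (∀ N → mzvPartial n k N ≤ fromℕ K) →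
  SquareSummable (K ℕ.* 2) (mzvPartial n (suc k)) ×
  (∀ N → mzvPartial n (suc k) N ≤ fromℕ (K ℕ.* 2))
mzv-step n k K prev prev≤K = weaken , total
  where
  sq : ℕ → ℚ
  sq N = recip (suc N) * recip (suc N)
  0≤sq : ∀ N → 0ℚ ≤ sq N
  0≤sq = 0≤recip²
  step : ℕ → ℚ
  step N = recip (suc N ℕ.^ n) * mzvPartial n k N
  0≤step : ∀ N → 0ℚ ≤ step N
  0≤step N = subst (_≤ step N) (*-zeroʳ (recip (suc N ℕ.^ n)))
    (*-monoˡ-≤-nonNeg (recip (suc N ℕ.^ n)) {{nonNegative (0≤recip (suc N ℕ.^ n))}}
      (S-nonNeg prev N))
  step≤ : ∀ N → step N ≤ fromℕ K * sq N
  step≤ N = subst (step N ≤_) (*-comm (sq N) (fromℕ K))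
    (*-mono-≤-nonNeg (S-nonNeg prev N) (0≤sq N) (recip-power N n) (prev≤K N))
  here : SquareSummable K (mzvPartial n (suc k))
  here = record
    { nonNeg₀  = ≤-refl
    ; increase = λ N → subst (mzvPartial n (suc k) N ≤_) (sym (mzvPartial-suc n k N))
        (p≤p+q (mzvPartial n (suc k) N) (0≤step N))
    ; bound    = λ N → subst (_≤ mzvPartial n (suc k) N + fromℕ K * sq N)
        (sym (mzvPartial-suc n k N)) (+-monoʳ-≤ (mzvPartial n (suc k) N) (step≤ N))
    }
  weaken : SquareSummable (K ℕ.* 2) (mzvPartial n (suc k))
  weaken = record
    { nonNeg₀  = SquareSummable.nonNeg₀ here
    ; increase = SquareSummable.increase here
    ; bound    = λ N → ≤-trans (SquareSummable.bound here N)
        (+-monoʳ-≤ (mzvPartial n (suc k) N)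
          (*-monoʳ-≤-nonNeg (sq N) {{nonNegative (0≤sq N)}} (fromℕ-mono (ℕ.m≤m*n K 2))))
    }
  total : ∀ N → mzvPartial n (suc k) N ≤ fromℕ (K ℕ.* 2)
  total N = subst (mzvPartial n (suc k) N ≤_)
    (trans (+-identityˡ _) (trans (cong (fromℕ K *_) (*-identityʳ (fromℕ 2)))
      (sym (fromℕ-* K 2))))
    (remainder here {0} {N} ℕ.z≤n)

mzv-summable : ∀ n k → .{{NonTrivial n}} →
  ∃ λ K → SquareSummable K (mzvPartial n k) × (∀ N → mzvPartial n k N ≤ fromℕ K)
mzv-summable n zero = 1 , summable , λ N → ≤-reflexive (one N)
  where
  sq : ℕ → ℚ
  sq N = recip (suc N) * recip (suc N)
  one : ∀ N → mzvPartial n 0 N ≡ 1ℚ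
  one N = trans (+-identityʳ (recip (1 ℕ.^ n))) (cong recip (ℕ.^-zeroˡ n))
  0≤1*sq : ∀ N → 0ℚ ≤ fromℕ 1 * sq N
  0≤1*sq N = subst (0ℚ ≤_) (sym (*-identityˡ (sq N))) (0≤recip² N)
  summable : SquareSummable 1 (mzvPartial n 0)
  summable = record
    { nonNeg₀  = subst (0ℚ ≤_) (sym (one 0)) (nonNegative⁻¹ 1ℚ)
    ; increase = λ N → subst₂ _≤_ (sym (one N)) (sym (one (suc N))) (≤-refl {1ℚ})
    ; bound    = λ N → subst₂ (λ p q → p ≤ q + fromℕ 1 * sq N)
        (sym (one (suc N))) (sym (one N)) (p≤p+q 1ℚ (0≤1*sq N))
    }

mzv-summable n (suc k) =
  let K , prev , prev≤K = mzv-summable n k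
  in K ℕ.* 2 , mzv-step n k K prev prev≤K

abstract

  zeta-cauchy : ∀ s → .{{NonTrivial s}} → Cauchy (zetaPartial s)
  zeta-cauchy s = summable⇒cauchy (zeta-summable s)

  mzv-cauchy : ∀ n k → .{{NonTrivial n}} → Cauchy (mzvPartial n k)
  mzv-cauchy n k =
    let K , summable , _ = mzv-summable n k in summable⇒cauchy summable

ζ : (s : ℕ) → .{{NonTrivial s}} → ℝ
ζ s = mkℝ (zetaPartial s) (zeta-cauchy s)

-- A convergent series of rationals is the real given by its partial sums; the
-- N-th approximation of ζ({n}^k) collects the terms with n₁ ≤ N.
ζ⟨｛_｝^_⟩ : (n k : ℕ) → .{{NonTrivial n}} → ℝ
ζ⟨｛ n ｝^ k ⟩ = mkℝ (mzvPartial n k) (mzv-cauchy n k)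

-- A formal linear combination Σ q · ζ(s₁) ⋯ ζ(s_r), with rational q and r ≥ 1
ZetaProduct ZetaCombination : Set
ZetaProduct     = List⁺ (Σ ℕ NonTrivial)
ZetaCombination = List (ℚ × ZetaProduct)

evaluateProduct : ZetaProduct → ℝ
evaluateProduct ss = productᴿ (map (λ (s , s≥2) → ζ s {{s≥2}}) (toList ss))

evaluate : ZetaCombination → ℝ
evaluate c = sumᴿ (map (λ (q , ss) → fromℚ q *ᴿ evaluateProduct ss) c)

-- Σ_{j ≥ 1} ζ(nj)/j z^{nj}
zetaSeries : (n : ℕ) → .{{NonTrivial n}} → PowerSeries
zetaSeries n = ∑ⱼ n {{ℕ.nonTrivial⇒nonZero n}}
  (λ j → ζ (n ℕ.* j) {{ℕ.n≢0∧m>1⇒m*n>1 n j}} /ᴿ j)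

-zetaSeries-constantTerm : (n : ℕ) → .{{_ : NonTrivial n}} →
  [z^ 0 ] (-ˢ zetaSeries n) ≃ 0ᴿ
-zetaSeries-constantTerm n =
  -∑ⱼ-constantTerm n {{ℕ.nonTrivial⇒nonZero n}}
    (λ j → ζ (n ℕ.* j) {{ℕ.n≢0∧m>1⇒m*n>1 n j}} /ᴿ j)

{-# OPTIONS --safe #-}
module Submission where

-- Every operation on reals in the statement acts on the M-th rational
-- approximations, so both identities may be proved for each M separately.  At
-- level M they concern the finitely many numbers x_m = 1/m^n with m ≤ M:
-- ζ(nj) becomes the power sum p_j = Σ x_m^j, and ζ({n}^k) becomes the
-- elementary symmetric polynomial e_k of the x_m.  Hence the claim is the
-- classical Σ_k (-1)^k e_k w^k = exp(-Σ_j p_j w^j / j), with w = z^n.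
--
-- Put a_k = (-1)^k e_k.  Newton's identities
--   (k+1) a_{k+1} = - Σ_{i ≤ k} p_{i+1} a_{k-i}
-- hold by induction on M (newton), because passing from M to M + 1 multiplies
-- the generating function by 1 - x w and adds the geometric series x^j to the
-- p_j.  On the other side, E = exp f satisfies θE = θf · E for θ = z d/dz
-- (θ-expSeries).  If f is supported on multiples of n, comparing the
-- coefficients of z^{n(k+1)} (⊛-multisection) gives the same recursion for the
-- coefficients of E at multiples of n.  The recursion determines a sequence
-- from its term of index 0 (recursion-unique), which proves the formula.
--
-- Solved for a_{k+1}, the recursion also exhibits e_{k+1} as a rational
-- combination of products of zeta values with coefficients independent of M
-- (signedMzv-combination).

open import Defs
open import Data.Nat.Base as ℕ using (ℕ; zero; suc; z≤n; s≤s; NonZero; NonTrivial; _*_; _∸_; _!)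
import Data.Nat.Properties as ℕ
open import Data.Nat.Divisibility as ℕ using (_∣_)
open import Data.Nat.Induction using (<-rec)
open import Data.Rational.Base using (ℚ; 0ℚ; 1ℚ; _+_; _-_; -_; _/_; ∣_∣; _<_)
  renaming (_*_ to _·_)
open import Data.Rational.Properties
open import Data.Rational.Solver using (module +-*-Solver)
open import Data.Integer.Base using (+_)
open import Data.List.Base using ([]; _∷_; _++_; map)
open import Data.List.NonEmpty.Base using (_∷_; _∷⁺_)
open import Data.Product.Base using (∃; _×_; _,_)
open import Relation.Nullary.Decidable using (yes; no)
open import Relation.Nullary.Negation using (¬_; contradiction)
open import Relation.Binary.PropositionalEquality
  using (_≡_; _≢_; refl; sym; trans; cong; cong₂; subst; module ≡-Reasoning)
open +-*-Solver
open ≡-Reasoning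

-- Finite sums of rationals

-- ∑ N f = f 0 + f 1 + ⋯ + f N
∑ : ℕ → (ℕ → ℚ) → ℚ
∑ zero    f = f 0
∑ (suc N) f = ∑ N f + f (suc N)

∑-cong : ∀ N {f g : ℕ → ℚ} → (∀ i → i ℕ.≤ N → f i ≡ g i) → ∑ N f ≡ ∑ N g
∑-cong zero    h = h 0 z≤n
∑-cong (suc N) h = cong₂ _+_ (∑-cong N λ i i≤N → h i (ℕ.m≤n⇒m≤1+n i≤N)) (h (suc N) ℕ.≤-refl)

∑-first : ∀ N (f : ℕ → ℚ) → ∑ (suc N) f ≡ f 0 + ∑ N (λ i → f (suc i))
∑-first zero    f = refl
∑-first (suc N) f = trans (cong (_+ f (suc (suc N))) (∑-first N f)) (+-assoc (f 0) _ _)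

∑-*ˡ : ∀ N q (f : ℕ → ℚ) → ∑ N (λ i → q · f i) ≡ q · ∑ N f
∑-*ˡ zero    q f = refl
∑-*ˡ (suc N) q f = trans (cong (_+ q · f (suc N)) (∑-*ˡ N q f)) (sym (*-distribˡ-+ q _ _))

∑-truncate : ∀ {m n} (f : ℕ → ℚ) → m ℕ.≤ n → (∀ i → m ℕ.< i → f i ≡ 0ℚ) → ∑ n f ≡ ∑ m f
∑-truncate {m} f m≤n zeros = go (ℕ.≤⇒≤′ m≤n)
  where
  go : ∀ {n} → m ℕ.≤′ n → ∑ n f ≡ ∑ m f
  go (ℕ.≤′-reflexive refl) = refl
  go {suc n} (ℕ.≤′-step m≤n) =
    trans (cong (_+_ (∑ n f)) (zeros (suc n) (s≤s (ℕ.≤′⇒≤ m≤n)))) (trans (+-identityʳ _) (go m≤n))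

∑-zero : ∀ N {f : ℕ → ℚ} → (∀ i → i ℕ.≤ N → f i ≡ 0ℚ) → ∑ N f ≡ 0ℚ
∑-zero zero    h = h 0 z≤n
∑-zero (suc N) h = cong₂ _+_ (∑-zero N λ i i≤N → h i (ℕ.m≤n⇒m≤1+n i≤N)) (h (suc N) ℕ.≤-refl)

∑-last : ∀ N (f : ℕ → ℚ) → (∀ i → i ℕ.< N → f i ≡ 0ℚ) → ∑ N f ≡ f N
∑-last zero    f h = refl
∑-last (suc N) f h =
  trans (cong (_+ f (suc N)) (∑-zero N λ i i≤N → h i (s≤s i≤N))) (+-identityˡ _)

∑-single : ∀ {m n} (f : ℕ → ℚ) → m ℕ.≤ n → (∀ i → i ≢ m → f i ≡ 0ℚ) → ∑ n f ≡ f m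
∑-single {m} f m≤n zeros = trans
  (∑-truncate f m≤n λ i m<i → zeros i (ℕ.>⇒≢ m<i))
  (∑-last m f λ i i<m → zeros i (ℕ.<⇒≢ i<m))

-- The Cauchy product of rational sequences

infixl 7 _⊛_
infixr 9 _⊛^_

shift : (ℕ → ℚ) → ℕ → ℚ
shift f i = f (suc i)

-- The Cauchy product, by recursion on the index:
-- (f₀ + z f′) g = f₀ g + z f′ g, where f′ is shift f.
_⊛_ : (ℕ → ℚ) → (ℕ → ℚ) → ℕ → ℚ
(f ⊛ g) zero    = f 0 · g 0
(f ⊛ g) (suc N) = f 0 · g (suc N) + (shift f ⊛ g) N

⊛-as-∑ : ∀ f g N → (f ⊛ g) N ≡ ∑ N λ i → f i · g (N ∸ i)
⊛-as-∑ f g zero    = refl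
⊛-as-∑ f g (suc N) = trans (cong (_+_ (f 0 · g (suc N))) (⊛-as-∑ (shift f) g N))
  (sym (∑-first N λ i → f i · g (suc N ∸ i)))

⊛-cong : ∀ N {f f′ g g′ : ℕ → ℚ} → (∀ i → i ℕ.≤ N → f i ≡ f′ i) →
         (∀ i → i ℕ.≤ N → g i ≡ g′ i) → (f ⊛ g) N ≡ (f′ ⊛ g′) N
⊛-cong zero    hf hg = cong₂ _·_ (hf 0 z≤n) (hg 0 z≤n)
⊛-cong (suc N) hf hg = cong₂ _+_
  (cong₂ _·_ (hf 0 z≤n) (hg (suc N) ℕ.≤-refl))
  (⊛-cong N (λ i i≤N → hf (suc i) (s≤s i≤N)) (λ i i≤N → hg i (ℕ.m≤n⇒m≤1+n i≤N)))

⊛-congˡ : ∀ N f {g g′ : ℕ → ℚ} → (∀ i → i ℕ.≤ N → g i ≡ g′ i) → (f ⊛ g) N ≡ (f ⊛ g′) N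
⊛-congˡ N f = ⊛-cong N {f} (λ _ _ → refl)

⊛-congʳ : ∀ N g {f f′ : ℕ → ℚ} → (∀ i → i ℕ.≤ N → f i ≡ f′ i) → (f ⊛ g) N ≡ (f′ ⊛ g) N
⊛-congʳ N g hf = ⊛-cong N {g = g} hf (λ _ _ → refl)

⊛-+ˡ : ∀ f g h N → ((λ i → f i + g i) ⊛ h) N ≡ (f ⊛ h) N + (g ⊛ h) N
⊛-+ˡ f g h zero    = *-distribʳ-+ (h 0) (f 0) (g 0)
⊛-+ˡ f g h (suc N) = trans
  (cong (_+_ ((f 0 + g 0) · h (suc N))) (⊛-+ˡ (shift f) (shift g) h N))
  (solve 5 (λ a b c x y → (a :+ b) :* c :+ (x :+ y) := (a :* c :+ x) :+ (b :* c :+ y)) refl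
    (f 0) (g 0) (h (suc N)) ((shift f ⊛ h) N) ((shift g ⊛ h) N))

⊛-*ˡ : ∀ q f g N → ((λ i → q · f i) ⊛ g) N ≡ q · (f ⊛ g) N
⊛-*ˡ q f g zero    = *-assoc q (f 0) (g 0)
⊛-*ˡ q f g (suc N) = trans (cong (_+_ (q · f 0 · g (suc N))) (⊛-*ˡ q (shift f) g N))
  (solve 4 (λ q a b x → q :* a :* b :+ q :* x := q :* (a :* b :+ x)) refl
    q (f 0) (g (suc N)) ((shift f ⊛ g) N))

-- The recursion peeling off the last coefficient of the left factor.
⊛-sucʳ : ∀ f g N → (f ⊛ g) (suc N) ≡ (f ⊛ shift g) N + f (suc N) · g 0
⊛-sucʳ f g zero    = refl
⊛-sucʳ f g (suc N) = trans (cong (_+_ (f 0 · g (suc (suc N)))) (⊛-sucʳ (shift f) g N))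
  (sym (+-assoc (f 0 · g (suc (suc N))) _ _))

⊛-comm : ∀ f g N → (f ⊛ g) N ≡ (g ⊛ f) N
⊛-comm f g zero    = *-comm (f 0) (g 0)
⊛-comm f g (suc N) = begin
  f 0 · g (suc N) + (shift f ⊛ g) N   ≡⟨ cong₂ _+_ (*-comm (f 0) (g (suc N))) (⊛-comm (shift f) g N) ⟩
  g (suc N) · f 0 + (g ⊛ shift f) N   ≡⟨ +-comm (g (suc N) · f 0) _ ⟩
  (g ⊛ shift f) N + g (suc N) · f 0   ≡⟨ ⊛-sucʳ g f N ⟨
  (g ⊛ f) (suc N)                     ∎

⊛-+ʳ : ∀ f g h N → (f ⊛ (λ i → g i + h i)) N ≡ (f ⊛ g) N + (f ⊛ h) N
⊛-+ʳ f g h N = begin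
  (f ⊛ (λ i → g i + h i)) N   ≡⟨ ⊛-comm f (λ i → g i + h i) N ⟩
  ((λ i → g i + h i) ⊛ f) N   ≡⟨ ⊛-+ˡ g h f N ⟩
  (g ⊛ f) N + (h ⊛ f) N       ≡⟨ cong₂ _+_ (⊛-comm g f N) (⊛-comm h f N) ⟩
  (f ⊛ g) N + (f ⊛ h) N       ∎

⊛-*ʳ : ∀ q f g N → (f ⊛ (λ i → q · g i)) N ≡ q · (f ⊛ g) N
⊛-*ʳ q f g N = begin
  (f ⊛ (λ i → q · g i)) N   ≡⟨ ⊛-comm f (λ i → q · g i) N ⟩
  ((λ i → q · g i) ⊛ f) N   ≡⟨ ⊛-*ˡ q g f N ⟩
  q · (g ⊛ f) N             ≡⟨ cong (_·_ q) (⊛-comm g f N) ⟩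
  q · (f ⊛ g) N             ∎

⊛-∑ʳ : ∀ M f (g : ℕ → ℕ → ℚ) N → (f ⊛ (λ i → ∑ M λ m → g m i)) N ≡ ∑ M λ m → (f ⊛ g m) N
⊛-∑ʳ zero    f g N = refl
⊛-∑ʳ (suc M) f g N = trans (⊛-+ʳ f (λ i → ∑ M λ m → g m i) (g (suc M)) N)
  (cong (_+ (f ⊛ g (suc M)) N) (⊛-∑ʳ M f g N))

⊛-assoc : ∀ f g h N → ((f ⊛ g) ⊛ h) N ≡ (f ⊛ (g ⊛ h)) N
⊛-assoc f g h zero    = *-assoc (f 0) (g 0) (h 0)
⊛-assoc f g h (suc N) = begin
  f 0 · g 0 · h (suc N) + ((λ i → f 0 · shift g i + (shift f ⊛ g) i) ⊛ h) N
    ≡⟨ cong (_+_ (f 0 · g 0 · h (suc N))) (begin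
         ((λ i → f 0 · shift g i + (shift f ⊛ g) i) ⊛ h) N
           ≡⟨ ⊛-+ˡ (λ i → f 0 · shift g i) (shift f ⊛ g) h N ⟩
         ((λ i → f 0 · shift g i) ⊛ h) N + ((shift f ⊛ g) ⊛ h) N
           ≡⟨ cong₂ _+_ (⊛-*ˡ (f 0) (shift g) h N) (⊛-assoc (shift f) g h N) ⟩
         f 0 · (shift g ⊛ h) N + (shift f ⊛ (g ⊛ h)) N ∎) ⟩
  f 0 · g 0 · h (suc N) + (f 0 · (shift g ⊛ h) N + (shift f ⊛ (g ⊛ h)) N)
    ≡⟨ solve 5 (λ a b c x y → a :* b :* c :+ (a :* x :+ y) := a :* (b :* c :+ x) :+ y) refl
         (f 0) (g 0) (h (suc N)) ((shift g ⊛ h) N) ((shift f ⊛ (g ⊛ h)) N) ⟩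
  f 0 · (g 0 · h (suc N) + (shift g ⊛ h) N) + (shift f ⊛ (g ⊛ h)) N ∎

⊛-leftComm : ∀ f g h N → (f ⊛ (g ⊛ h)) N ≡ (g ⊛ (f ⊛ h)) N
⊛-leftComm f g h N = begin
  (f ⊛ (g ⊛ h)) N   ≡⟨ ⊛-assoc f g h N ⟨
  ((f ⊛ g) ⊛ h) N   ≡⟨ ⊛-congʳ N h (λ i _ → ⊛-comm f g i) ⟩
  ((g ⊛ f) ⊛ h) N   ≡⟨ ⊛-assoc g f h N ⟩
  (g ⊛ (f ⊛ h)) N   ∎

⊛-zeroʳ : ∀ N f {g : ℕ → ℚ} → (∀ i → i ℕ.≤ N → g i ≡ 0ℚ) → (f ⊛ g) N ≡ 0ℚ
⊛-zeroʳ N f {g} zeros = begin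
  (f ⊛ g) N                  ≡⟨ ⊛-as-∑ f g N ⟩
  ∑ N (λ i → f i · g (N ∸ i)) ≡⟨ ∑-zero N (λ i _ → trans (cong (_·_ (f i)) (zeros (N ∸ i) (ℕ.m∸n≤m N i))) (*-zeroʳ (f i))) ⟩
  0ℚ ∎

-- Leading zeros of the left factor only shift the product.
⊛-leadingZeros : ∀ r f g N → (∀ i → i ℕ.< r → f i ≡ 0ℚ) →
                 (f ⊛ g) (r ℕ.+ N) ≡ ((λ i → f (r ℕ.+ i)) ⊛ g) N
⊛-leadingZeros zero    f g N zeros = refl
⊛-leadingZeros (suc r) f g N zeros = begin
  f 0 · g (suc (r ℕ.+ N)) + (shift f ⊛ g) (r ℕ.+ N)
    ≡⟨ cong₂ _+_ (trans (cong (_· g (suc (r ℕ.+ N))) (zeros 0 (s≤s z≤n))) (*-zeroˡ (g (suc (r ℕ.+ N)))))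
         (⊛-leadingZeros r (shift f) g N (λ i i<r → zeros (suc i) (s≤s i<r))) ⟩
  0ℚ + ((λ i → f (suc r ℕ.+ i)) ⊛ g) N
    ≡⟨ +-identityˡ _ ⟩
  ((λ i → f (suc r ℕ.+ i)) ⊛ g) N ∎

-- If f is a series in z^n, the coefficients of f g at multiples of n are those
-- of a product of series in z^n.
⊛-multisection : ∀ n .{{_ : NonZero n}} f g → (∀ i → ¬ n ∣ i → f i ≡ 0ℚ) → ∀ k →
  (f ⊛ g) (n * k) ≡ ((λ i → f (n * i)) ⊛ (λ i → g (n * i))) k
⊛-multisection n f g support zero rewrite ℕ.*-zeroʳ n = refl
⊛-multisection n@(suc r) f g support (suc k) = begin
  (f ⊛ g) (n * suc k)
    ≡⟨ cong (f ⊛ g) (ℕ.*-suc n k) ⟩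
  f 0 · g (n ℕ.+ n * k) + (shift f ⊛ g) (r ℕ.+ n * k)
    ≡⟨ cong₂ _+_ (cong₂ (λ i j → f i · g j) (sym (ℕ.*-zeroʳ n)) (sym (ℕ.*-suc n k)))
         (⊛-leadingZeros r (shift f) g (n * k) λ i i<r →
           support (suc i) λ n∣1+i → ℕ.<⇒≱ (s≤s i<r) (ℕ.∣⇒≤ n∣1+i)) ⟩
  f (n * 0) · g (n * suc k) + ((λ i → f (n ℕ.+ i)) ⊛ g) (n * k)
    ≡⟨ cong (_+_ (f (n * 0) · g (n * suc k)))
         (⊛-multisection n (λ i → f (n ℕ.+ i)) g
           (λ i n∤i → support (n ℕ.+ i) λ n∣n+i → n∤i (ℕ.∣m+n∣m⇒∣n n∣n+i ℕ.∣-refl)) k) ⟩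
  f (n * 0) · g (n * suc k) + ((λ i → f (n ℕ.+ n * i)) ⊛ (λ i → g (n * i))) k
    ≡⟨ cong (_+_ (f (n * 0) · g (n * suc k)))
         (⊛-congʳ k (λ i → g (n * i)) λ i _ → cong f (sym (ℕ.*-suc n i))) ⟩
  ((λ i → f (n * i)) ⊛ (λ i → g (n * i))) (suc k) ∎

-- Powers for the Cauchy product; f ⊛^ 0 is the constant series 1.
_⊛^_ : (ℕ → ℚ) → ℕ → ℕ → ℚ
(f ⊛^ zero)  zero    = 1ℚ
(f ⊛^ zero)  (suc N) = 0ℚ
(f ⊛^ suc m) N       = (f ⊛ f ⊛^ m) N

⊛^-zero : ∀ f → f 0 ≡ 0ℚ → ∀ m i → i ℕ.< m → (f ⊛^ m) i ≡ 0ℚ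
⊛^-zero f f₀≡0 (suc m) zero    _         =
  trans (cong (_· (f ⊛^ m) 0) f₀≡0) (*-zeroˡ ((f ⊛^ m) 0))
⊛^-zero f f₀≡0 (suc m) (suc i) (s≤s i<m) = cong₂ _+_
  (trans (cong (_· (f ⊛^ m) (suc i)) f₀≡0) (*-zeroˡ ((f ⊛^ m) (suc i))))
  (⊛-zeroʳ i (shift f) λ j j≤i → ⊛^-zero f f₀≡0 m j (ℕ.≤-<-trans j≤i i<m))

-- The exponential and its differential equation

-- The derivation z d/dz
θ : (ℕ → ℚ) → ℕ → ℚ
θ f i = fromℕ i · f i

fromℕ-suc : ∀ m → fromℕ (suc m) ≡ 1ℚ + fromℕ m
fromℕ-suc m = fromℕ-+ 1 m

θ-⊛ : ∀ f g N → θ (f ⊛ g) N ≡ (θ f ⊛ g) N + (f ⊛ θ g) N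
θ-⊛ f g zero    =
  solve 2 (λ a b → con 0ℚ :* (a :* b) := con 0ℚ :* a :* b :+ a :* (con 0ℚ :* b)) refl (f 0) (g 0)
θ-⊛ f g (suc N) = begin
  fromℕ (suc N) · (a · b + X)
    ≡⟨ cong (_· (a · b + X)) (fromℕ-suc N) ⟩
  (1ℚ + fromℕ N) · (a · b + X)
    ≡⟨ solve 3 (λ n p x → (con 1ℚ :+ n) :* (p :+ x) := (con 1ℚ :+ n) :* p :+ x :+ n :* x) refl
         (fromℕ N) (a · b) X ⟩
  (1ℚ + fromℕ N) · (a · b) + X + fromℕ N · X
    ≡⟨ cong₂ (λ t u → t · (a · b) + X + u) (sym (fromℕ-suc N)) (θ-⊛ (shift f) g N) ⟩
  fromℕ (suc N) · (a · b) + X + (A + B)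
    ≡⟨ solve 6 (λ n a b x s t → n :* (a :* b) :+ x :+ (s :+ t)
                 := (con 0ℚ :* a :* b :+ (s :+ x)) :+ (a :* (n :* b) :+ t)) refl
         (fromℕ (suc N)) a b X A B ⟩
  (θ f 0 · b + (A + X)) + (a · θ g (suc N) + B)
    ≡⟨ cong (λ t → (θ f 0 · b + t) + (a · θ g (suc N) + B)) A+X ⟩
  (θ f ⊛ g) (suc N) + (f ⊛ θ g) (suc N) ∎
  where
  a = f 0
  b = g (suc N)
  X = (shift f ⊛ g) N
  A = (θ (shift f) ⊛ g) N
  B = (shift f ⊛ θ g) N
  A+X : A + X ≡ (shift (θ f) ⊛ g) N
  A+X = trans (sym (⊛-+ˡ (θ (shift f)) (shift f) g N)) (⊛-congʳ N g λ i _ →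
    trans (solve 2 (λ n y → n :* y :+ y := (con 1ℚ :+ n) :* y) refl (fromℕ i) (f (suc i)))
      (cong (_· f (suc i)) (sym (fromℕ-suc i))))

θ-one : ∀ f N → θ (f ⊛^ 0) N ≡ 0ℚ
θ-one f zero    = refl
θ-one f (suc N) = *-zeroʳ (fromℕ (suc N))

θ-⊛^ : ∀ f m N → θ (f ⊛^ suc m) N ≡ fromℕ (suc m) · (θ f ⊛ f ⊛^ m) N
θ-⊛^ f zero    N = begin
  θ (f ⊛ f ⊛^ 0) N                          ≡⟨ θ-⊛ f (f ⊛^ 0) N ⟩
  (θ f ⊛ f ⊛^ 0) N + (f ⊛ θ (f ⊛^ 0)) N     ≡⟨ cong (_+_ ((θ f ⊛ f ⊛^ 0) N)) (⊛-zeroʳ N f λ i _ → θ-one f i) ⟩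
  (θ f ⊛ f ⊛^ 0) N + 0ℚ                     ≡⟨ +-identityʳ _ ⟩
  (θ f ⊛ f ⊛^ 0) N                          ≡⟨ *-identityˡ _ ⟨
  fromℕ 1 · (θ f ⊛ f ⊛^ 0) N                ∎
θ-⊛^ f (suc m) N = begin
  θ (f ⊛ f ⊛^ suc m) N
    ≡⟨ θ-⊛ f (f ⊛^ suc m) N ⟩
  Y + (f ⊛ θ (f ⊛^ suc m)) N
    ≡⟨ cong (_+_ Y) (⊛-congˡ N f λ i _ → θ-⊛^ f m i) ⟩
  Y + (f ⊛ (λ i → fromℕ (suc m) · (θ f ⊛ f ⊛^ m) i)) N
    ≡⟨ cong (_+_ Y) (⊛-*ʳ (fromℕ (suc m)) f (θ f ⊛ f ⊛^ m) N) ⟩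
  Y + fromℕ (suc m) · (f ⊛ (θ f ⊛ f ⊛^ m)) N
    ≡⟨ cong (λ t → Y + fromℕ (suc m) · t) (⊛-leftComm f (θ f) (f ⊛^ m) N) ⟩
  Y + fromℕ (suc m) · Y
    ≡⟨ solve 2 (λ y n → y :+ n :* y := (con 1ℚ :+ n) :* y) refl Y (fromℕ (suc m)) ⟩
  (1ℚ + fromℕ (suc m)) · Y
    ≡⟨ cong (_· Y) (fromℕ-suc (suc m)) ⟨
  fromℕ (suc (suc m)) · Y ∎
  where Y = (θ f ⊛ f ⊛^ suc m) N

-- exp f for a series f without constant term: powers beyond the N-th do not
-- contribute to the coefficient of index N.
expSeries : (ℕ → ℚ) → ℕ → ℚ
expSeries f N = ∑ N λ m → recip (m !) · (f ⊛^ m) N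

fromℕ-recip : ∀ m → fromℕ (suc m) · recip (suc m) ≡ 1ℚ
fromℕ-recip m = trans (*-comm (fromℕ (suc m)) (recip (suc m))) (recip-mul m)

recip-!-suc : ∀ m → recip (suc m !) · fromℕ (suc m) ≡ recip (m !)
recip-!-suc m = begin
  recip (suc m * m !) · fromℕ (suc m)
    ≡⟨ cong (_· fromℕ (suc m)) (recip-* (suc m) (m !)) ⟩
  recip (suc m) · recip (m !) · fromℕ (suc m)
    ≡⟨ solve 3 (λ r s n → r :* s :* n := (r :* n) :* s) refl
         (recip (suc m)) (recip (m !)) (fromℕ (suc m)) ⟩
  recip (suc m) · fromℕ (suc m) · recip (m !)
    ≡⟨ cong (_· recip (m !)) (recip-mul m) ⟩
  1ℚ · recip (m !)
    ≡⟨ *-identityˡ (recip (m !)) ⟩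
  recip (m !) ∎

θ-expSeries : ∀ f → f 0 ≡ 0ℚ → ∀ N → θ (expSeries f) N ≡ (θ f ⊛ expSeries f) N
θ-expSeries f f₀≡0 zero    =
  solve 2 (λ e a → con 0ℚ :* e := con 0ℚ :* a :* e) refl (expSeries f 0) (f 0)
θ-expSeries f f₀≡0 (suc N) = begin
  fromℕ (suc N) · ∑ (suc N) (λ m → r m · (f ⊛^ m) (suc N))
    ≡⟨ ∑-*ˡ (suc N) (fromℕ (suc N)) (λ m → r m · (f ⊛^ m) (suc N)) ⟨
  ∑ (suc N) (λ m → fromℕ (suc N) · (r m · (f ⊛^ m) (suc N)))
    ≡⟨ ∑-first N (λ m → fromℕ (suc N) · (r m · (f ⊛^ m) (suc N))) ⟩
  fromℕ (suc N) · (r 0 · 0ℚ) + ∑ N (λ m → fromℕ (suc N) · (r (suc m) · (f ⊛^ suc m) (suc N)))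
    ≡⟨ cong₂ _+_ (*-zeroʳ (fromℕ (suc N))) (∑-cong N λ m _ → term m) ⟩
  0ℚ + ∑ N (λ m → (f′ ⊛ (λ i → r m · (f ⊛^ m) i)) N)
    ≡⟨ +-identityˡ _ ⟩
  ∑ N (λ m → (f′ ⊛ (λ i → r m · (f ⊛^ m) i)) N)
    ≡⟨ ⊛-∑ʳ N f′ (λ m i → r m · (f ⊛^ m) i) N ⟨
  (f′ ⊛ (λ i → ∑ N λ m → r m · (f ⊛^ m) i)) N
    ≡⟨ ⊛-congˡ N f′ (λ i i≤N → ∑-truncate (λ m → r m · (f ⊛^ m) i) i≤N λ m i<m →
         trans (cong (_·_ (r m)) (⊛^-zero f f₀≡0 m i i<m)) (*-zeroʳ (r m))) ⟩
  (f′ ⊛ expSeries f) N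
    ≡⟨ dropFirst (expSeries f) ⟨
  (θ f ⊛ expSeries f) (suc N) ∎
  where
  r : ℕ → ℚ
  r m = recip (m !)
  f′ = shift (θ f)
  -- θ f has no constant term.
  dropFirst : ∀ g → (θ f ⊛ g) (suc N) ≡ (f′ ⊛ g) N
  dropFirst g = solve 3 (λ a b x → con 0ℚ :* a :* b :+ x := x) refl (f 0) (g (suc N)) ((f′ ⊛ g) N)
  term : ∀ m → fromℕ (suc N) · (r (suc m) · (f ⊛^ suc m) (suc N)) ≡
               (f′ ⊛ (λ i → r m · (f ⊛^ m) i)) N
  term m = begin
    fromℕ (suc N) · (r (suc m) · (f ⊛^ suc m) (suc N))
      ≡⟨ solve 3 (λ n r p → n :* (r :* p) := r :* (n :* p)) refl
           (fromℕ (suc N)) (r (suc m)) ((f ⊛^ suc m) (suc N)) ⟩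
    r (suc m) · θ (f ⊛^ suc m) (suc N)
      ≡⟨ cong (_·_ (r (suc m))) (θ-⊛^ f m (suc N)) ⟩
    r (suc m) · (fromℕ (suc m) · (θ f ⊛ f ⊛^ m) (suc N))
      ≡⟨ *-assoc (r (suc m)) (fromℕ (suc m)) ((θ f ⊛ f ⊛^ m) (suc N)) ⟨
    r (suc m) · fromℕ (suc m) · (θ f ⊛ f ⊛^ m) (suc N)
      ≡⟨ cong₂ _·_ (recip-!-suc m) (dropFirst (f ⊛^ m)) ⟩
    r m · (f′ ⊛ f ⊛^ m) N
      ≡⟨ ⊛-*ʳ (r m) f′ (f ⊛^ m) N ⟨
    (f′ ⊛ (λ i → r m · (f ⊛^ m) i)) N ∎

-- Newton's recursion

-- The differential equation da/dw = c a for power series in w: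
-- (k+1) a_{k+1} = Σ_{i ≤ k} c_i a_{k-i}
Recursion : (ℕ → ℚ) → (ℕ → ℚ) → Set
Recursion c a = ∀ k → fromℕ (suc k) · a (suc k) ≡ (c ⊛ a) k

fromℕ-cancelˡ : ∀ m {p q} → fromℕ (suc m) · p ≡ fromℕ (suc m) · q → p ≡ q
fromℕ-cancelˡ m {p} {q} eq = trans (sym (undo p)) (trans (cong (_·_ (recip (suc m))) eq) (undo q))
  where
  undo : ∀ p → recip (suc m) · (fromℕ (suc m) · p) ≡ p
  undo p = trans (sym (*-assoc (recip (suc m)) (fromℕ (suc m)) p))
    (trans (cong (_· p) (recip-mul m)) (*-identityˡ p))

recursion-unique : ∀ {c a b} → Recursion c a → Recursion c b → a 0 ≡ b 0 → ∀ k → a k ≡ b k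
recursion-unique {c} {a} {b} ra rb a₀≡b₀ = <-rec _ step
  where
  step : ∀ k → (∀ {i} → i ℕ.< k → a i ≡ b i) → a k ≡ b k
  step zero    ih = a₀≡b₀
  step (suc k) ih = fromℕ-cancelˡ k (begin
    fromℕ (suc k) · a (suc k)   ≡⟨ ra k ⟩
    (c ⊛ a) k                   ≡⟨ ⊛-congˡ k c (λ i i≤k → ih (s≤s i≤k)) ⟩
    (c ⊛ b) k                   ≡⟨ rb k ⟨
    fromℕ (suc k) · b (suc k)   ∎)

-- If f(z) = φ(z^n) with φ(0) = 0, then the coefficients of exp f at multiples
-- of n satisfy the recursion of exp φ.
expSeries-recursion : ∀ n .{{_ : NonZero n}} f → f 0 ≡ 0ℚ → (∀ i → ¬ n ∣ i → f i ≡ 0ℚ) →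
  Recursion (shift (θ (λ i → f (n * i)))) (λ i → expSeries f (n * i))
expSeries-recursion n@(suc n-1) f f₀≡0 support k = fromℕ-cancelˡ n-1 (begin
  fromℕ n · (fromℕ (suc k) · E (suc k))
    ≡⟨ *-assoc (fromℕ n) (fromℕ (suc k)) (E (suc k)) ⟨
  fromℕ n · fromℕ (suc k) · E (suc k)
    ≡⟨ cong (_· E (suc k)) (fromℕ-* n (suc k)) ⟨
  θ (expSeries f) (n * suc k)
    ≡⟨ θ-expSeries f f₀≡0 (n * suc k) ⟩
  (θ f ⊛ expSeries f) (n * suc k)
    ≡⟨ ⊛-multisection n (θ f) (expSeries f)
         (λ i n∤i → trans (cong (_·_ (fromℕ i)) (support i n∤i)) (*-zeroʳ (fromℕ i))) (suc k) ⟩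
  ((λ i → θ f (n * i)) ⊛ E) (suc k)
    ≡⟨ ⊛-congʳ (suc k) E (λ i _ → trans (cong (_· f (n * i)) (fromℕ-* n i))
         (*-assoc (fromℕ n) (fromℕ i) (f (n * i)))) ⟩
  ((λ i → fromℕ n · θ φ i) ⊛ E) (suc k)
    ≡⟨ ⊛-*ˡ (fromℕ n) (θ φ) E (suc k) ⟩
  fromℕ n · (fromℕ 0 · φ 0 · E (suc k) + (shift (θ φ) ⊛ E) k)
    ≡⟨ cong (_·_ (fromℕ n)) (solve 3 (λ a b x → con 0ℚ :* a :* b :+ x := x) refl
         (φ 0) (E (suc k)) ((shift (θ φ) ⊛ E) k)) ⟩
  fromℕ n · (shift (θ φ) ⊛ E) k ∎)
  where
  φ E : ℕ → ℚ
  φ i = f (n * i)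
  E i = expSeries f (n * i)

-- The two hypotheses say that a′ is the product (1 - x w) a.
module _ {x : ℚ} {a a′ : ℕ → ℚ} (a′₀ : a′ 0 ≡ a 0)
         (a′₊ : ∀ k → a′ (suc k) ≡ a (suc k) - x · a k) where

  -- (Σ_i x^{i+1} w^i) (1 - x w) a = x a; here g is the geometric series.
  geometric-⊛ : ∀ g → g 0 ≡ x → (∀ i → g (suc i) ≡ x · g i) → ∀ k → (g ⊛ a′) k ≡ x · a k
  geometric-⊛ g g₀ g₊ zero    = cong₂ _·_ g₀ a′₀
  geometric-⊛ g g₀ g₊ (suc k) = begin
    g 0 · a′ (suc k) + (shift g ⊛ a′) k
      ≡⟨ cong₂ _+_ (cong₂ _·_ g₀ (a′₊ k)) (⊛-congʳ k a′ λ i _ → g₊ i) ⟩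
    x · (a (suc k) - x · a k) + ((λ i → x · g i) ⊛ a′) k
      ≡⟨ cong (_+_ (x · (a (suc k) - x · a k)))
           (trans (⊛-*ˡ x g a′ k) (cong (_·_ x) (geometric-⊛ g g₀ g₊ k))) ⟩
    x · (a (suc k) - x · a k) + x · (x · a k)
      ≡⟨ solve 3 (λ x p q → x :* (p :- x :* q) :+ x :* (x :* q) := x :* p) refl x (a (suc k)) (a k) ⟩
    x · a (suc k) ∎

  ⊛-linearFactor : ∀ c k → (c ⊛ a′) (suc k) ≡ (c ⊛ a) (suc k) - x · (c ⊛ a) k
  ⊛-linearFactor c k = begin
    (c ⊛ a′) (suc k)
      ≡⟨ ⊛-sucʳ c a′ k ⟩
    (c ⊛ shift a′) k + c (suc k) · a′ 0
      ≡⟨ cong₂ _+_ (⊛-congˡ k c λ i _ → trans (a′₊ i) (cong (_+_ (a (suc i)))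
           (solve 2 (λ x p → :- (x :* p) := :- x :* p) refl x (a i))))
           (cong (_·_ (c (suc k))) a′₀) ⟩
    (c ⊛ (λ i → a (suc i) + - x · a i)) k + c (suc k) · a 0
      ≡⟨ cong (_+ c (suc k) · a 0) (trans (⊛-+ʳ c (shift a) (λ i → - x · a i) k)
           (cong (_+_ ((c ⊛ shift a) k)) (⊛-*ʳ (- x) c a k))) ⟩
    (c ⊛ shift a) k + - x · (c ⊛ a) k + c (suc k) · a 0
      ≡⟨ solve 4 (λ s x y t → s :+ :- x :* y :+ t := s :+ t :- x :* y) refl
           ((c ⊛ shift a) k) x ((c ⊛ a) k) (c (suc k) · a 0) ⟩
    (c ⊛ shift a) k + c (suc k) · a 0 - x · (c ⊛ a) k
      ≡⟨ cong (_- x · (c ⊛ a) k) (⊛-sucʳ c a k) ⟨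
    (c ⊛ a) (suc k) - x · (c ⊛ a) k ∎

  -- Multiplying a by 1 - x w adds its logarithmic derivative
  -- - Σ_i x^{i+1} w^i to c.
  recursion-linearFactor : ∀ {c c′} g → g 0 ≡ x → (∀ i → g (suc i) ≡ x · g i) →
    (∀ i → c′ i ≡ c i + - 1ℚ · g i) → Recursion c a → Recursion c′ a′
  recursion-linearFactor {c} {c′} g g₀ g₊ c′≡ ra k = sym (begin
    (c′ ⊛ a′) k
      ≡⟨ ⊛-congʳ k a′ (λ i _ → c′≡ i) ⟩
    ((λ i → c i + - 1ℚ · g i) ⊛ a′) k
      ≡⟨ trans (⊛-+ˡ c (λ i → - 1ℚ · g i) a′ k)
           (cong (_+_ ((c ⊛ a′) k)) (trans (⊛-*ˡ (- 1ℚ) g a′ k)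
             (cong (_·_ (- 1ℚ)) (geometric-⊛ g g₀ g₊ k)))) ⟩
    (c ⊛ a′) k + - 1ℚ · (x · a k)
      ≡⟨ combine k ⟩
    fromℕ (suc k) · (a (suc k) - x · a k)
      ≡⟨ cong (_·_ (fromℕ (suc k))) (a′₊ k) ⟨
    fromℕ (suc k) · a′ (suc k) ∎)
    where
    combine : ∀ k → (c ⊛ a′) k + - 1ℚ · (x · a k) ≡ fromℕ (suc k) · (a (suc k) - x · a k)
    combine zero    = begin
      c 0 · a′ 0 + - 1ℚ · (x · a 0)
        ≡⟨ cong (_+ - 1ℚ · (x · a 0)) (trans (cong (_·_ (c 0)) a′₀) (sym (ra 0))) ⟩
      1ℚ · a 1 + - 1ℚ · (x · a 0)
        ≡⟨ solve 3 (λ p x q → con 1ℚ :* p :+ con (- 1ℚ) :* (x :* q) := con 1ℚ :* (p :- x :* q)) refl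
             (a 1) x (a 0) ⟩
      1ℚ · (a 1 - x · a 0) ∎
    combine (suc k) = begin
      (c ⊛ a′) (suc k) + - 1ℚ · (x · p)
        ≡⟨ cong (_+ - 1ℚ · (x · p)) (trans (⊛-linearFactor c k)
             (cong₂ (λ s t → s - x · t) (sym (ra (suc k))) (sym (ra k)))) ⟩
      fromℕ (suc (suc k)) · q - x · (fromℕ (suc k) · p) + - 1ℚ · (x · p)
        ≡⟨ cong (λ t → t · q - x · (fromℕ (suc k) · p) + - 1ℚ · (x · p)) (fromℕ-suc (suc k)) ⟩
      (1ℚ + fromℕ (suc k)) · q - x · (fromℕ (suc k) · p) + - 1ℚ · (x · p)
        ≡⟨ solve 4 (λ n q x p → (con 1ℚ :+ n) :* q :- x :* (n :* p) :+ con (- 1ℚ) :* (x :* p)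
                     := (con 1ℚ :+ n) :* (q :- x :* p)) refl (fromℕ (suc k)) q x p ⟩
      (1ℚ + fromℕ (suc k)) · (q - x · p)
        ≡⟨ cong (_· (q - x · p)) (fromℕ-suc (suc k)) ⟨
      fromℕ (suc (suc k)) · (q - x · p) ∎
      where
      p = a (suc k)
      q = a (suc (suc k))

-- Truncated zeta values

-- (-1)^k
sign : ℕ → ℚ
sign zero    = 1ℚ
sign (suc k) = - 1ℚ · sign k

sign-square : ∀ k → sign k · sign k ≡ 1ℚ
sign-square zero    = refl
sign-square (suc k) = trans
  (solve 1 (λ s → con (- 1ℚ) :* s :* (con (- 1ℚ) :* s) := s :* s) refl (sign k)) (sign-square k)

-- (-1)^k times the k-th elementary symmetric polynomial of 1/m^n, 1 ≤ m ≤ M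
signedMzv : ℕ → ℕ → ℕ → ℚ
signedMzv n M k = sign k · mzvPartial n k M

sign-signedMzv : ∀ n M k → sign k · signedMzv n M k ≡ mzvPartial n k M
sign-signedMzv n M k = trans (sym (*-assoc (sign k) (sign k) (mzvPartial n k M)))
  (trans (cong (_· mzvPartial n k M) (sign-square k)) (*-identityˡ _))

signedMzv-zero : ∀ n M → signedMzv n M 0 ≡ 1ℚ
signedMzv-zero n M = cong (λ t → 1ℚ · (t + 0ℚ)) (cong recip (ℕ.^-zeroˡ n))

-- The negated power sums of 1/m^n, 1 ≤ m ≤ M, indexed from the first power
negPowerSum : ℕ → ℕ → ℕ → ℚ
negPowerSum n M i = - 1ℚ · zetaPartial (n * suc i) M

newton : ∀ n M → Recursion (negPowerSum n M) (signedMzv n M)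
newton n zero    k = trans
  (trans (cong (_·_ (fromℕ (suc k))) (*-zeroʳ (sign (suc k)))) (*-zeroʳ (fromℕ (suc k))))
  (sym (trans (⊛-comm (negPowerSum n 0) (signedMzv n 0) k)
    (⊛-zeroʳ k (signedMzv n 0) λ _ _ → refl)))
newton n (suc M) = recursion-linearFactor {x} refl step g
    (cong (λ e → recip (suc M ℕ.^ e)) (ℕ.*-identityʳ n)) geometric
    (λ i → *-distribˡ-+ (- 1ℚ) (zetaPartial (n * suc i) M) (g i)) (newton n M)
  where
  x = recip (suc M ℕ.^ n)
  g : ℕ → ℚ
  g i = recip (suc M ℕ.^ (n * suc i))
  geometric : ∀ i → g (suc i) ≡ x · g i
  geometric i = begin
    recip (suc M ℕ.^ (n * suc (suc i)))           ≡⟨ cong (λ e → recip (suc M ℕ.^ e)) (ℕ.*-suc n (suc i)) ⟩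
    recip (suc M ℕ.^ (n ℕ.+ n * suc i))           ≡⟨ cong recip (ℕ.^-distribˡ-+-* (suc M) n (n * suc i)) ⟩
    recip (suc M ℕ.^ n * suc M ℕ.^ (n * suc i))   ≡⟨ recip-* (suc M ℕ.^ n) (suc M ℕ.^ (n * suc i)) ⟩
    x · g i                                       ∎
  step : ∀ k → signedMzv n (suc M) (suc k) ≡ signedMzv n M (suc k) - x · signedMzv n M k
  step k = trans (cong (_·_ (sign (suc k))) (mzvPartial-suc n k M))
    (solve 4 (λ s p x q → con (- 1ℚ) :* s :* (p :+ x :* q) := con (- 1ℚ) :* s :* p :- x :* (s :* q)) refl
      (sign k) (mzvPartial n (suc k) M) x (mzvPartial n k M))

-- Rational approximations of the real power series

pointwise⇒≃ : ∀ x y → (∀ M → seq x M ≡ seq y M) → x ≃ y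
pointwise⇒≃ x y x≡y ε 0<ε = 0 , λ M _ →
  subst (λ q → ∣ seq x M - q ∣ < ε) (x≡y M) (subst (λ q → ∣ q ∣ < ε) (sym (p-p≡0 (seq x M))) 0<ε)

seq-∑≤ : ∀ M N x → seq (∑≤ N x) M ≡ ∑ N λ i → seq (x i) M
seq-∑≤ M zero    x = refl
seq-∑≤ M (suc N) x = cong (_+ seq (x (suc N)) M) (seq-∑≤ M N x)

seq-^ˢ : ∀ M f m N → seq ((f ^ˢ m) N) M ≡ ((λ i → seq (f i) M) ⊛^ m) N
seq-^ˢ M f zero    zero    = refl
seq-^ˢ M f zero    (suc N) = refl
seq-^ˢ M f (suc m) N       = begin
  seq (∑≤ N λ i → f i *ᴿ (f ^ˢ m) (N ∸ i)) M
    ≡⟨ seq-∑≤ M N (λ i → f i *ᴿ (f ^ˢ m) (N ∸ i)) ⟩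
  ∑ N (λ i → F i · seq ((f ^ˢ m) (N ∸ i)) M)
    ≡⟨ ∑-cong N (λ i _ → cong (_·_ (F i)) (seq-^ˢ M f m (N ∸ i))) ⟩
  ∑ N (λ i → F i · (F ⊛^ m) (N ∸ i))
    ≡⟨ ⊛-as-∑ F (F ⊛^ m) N ⟨
  (F ⊛ F ⊛^ m) N ∎
  where
  F : ℕ → ℚ
  F i = seq (f i) M

1/≡recip : ∀ m .{{_ : NonZero m}} → + 1 / m ≡ recip m
1/≡recip (suc m) = refl

seq-exp : ∀ M f f₀≃0 N → seq ([z^ N ] exp f f₀≃0) M ≡ expSeries (λ i → seq (f i) M) N
seq-exp M f f₀≃0 N = trans
  (seq-∑≤ M N (λ m → ((1ᴿ /ᴿ m !) {{m ℕ.!≢0}} ·ˢ (f ^ˢ m)) N))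
  (∑-cong N λ m _ → cong₂ _·_
    (trans (*-identityˡ _) (1/≡recip (m !) {{m ℕ.!≢0}})) (seq-^ˢ M f m N))

seq-sign : ∀ M k → seq ((-ᴿ 1ᴿ) ^ᴿ k) M ≡ sign k
seq-sign M zero    = refl
seq-sign M (suc k) = cong (_·_ (- 1ℚ)) (seq-sign M k)

monomial-hit : ∀ x e → monomial x e e ≡ x
monomial-hit x e with e ℕ.≟ e
... | yes _   = refl
... | no  e≢e = contradiction refl e≢e

monomial-miss : ∀ x e N → N ≢ e → monomial x e N ≡ 0ᴿ
monomial-miss x e N N≢e with N ℕ.≟ e
... | yes N≡e = contradiction N≡e N≢e
... | no  _   = refl

module _ (n : ℕ) .{{_ : NonZero n}} (a : (j : ℕ) → .{{NonZero j}} → ℝ) where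

  seq-∑ⱼ-multiple : ∀ M j → seq (∑ⱼ n a (n * suc j)) M ≡ seq (a (suc j)) M
  seq-∑ⱼ-multiple M j = begin
    seq (∑ⱼ n a (n * suc j)) M
      ≡⟨ seq-∑≤ M (n * suc j) (λ i → monomial (a (suc i)) (n * suc i) (n * suc j)) ⟩
    ∑ (n * suc j) (λ i → seq (monomial (a (suc i)) (n * suc i) (n * suc j)) M)
      ≡⟨ ∑-single (λ i → seq (monomial (a (suc i)) (n * suc i) (n * suc j)) M)
           (ℕ.≤-trans (ℕ.n≤1+n j) (ℕ.m≤n*m (suc j) n))
           (λ i i≢j → cong (λ y → seq y M) (monomial-miss (a (suc i)) (n * suc i) (n * suc j)
             λ eq → i≢j (ℕ.suc-injective (sym (ℕ.*-cancelˡ-≡ (suc j) (suc i) n eq))))) ⟩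
    seq (monomial (a (suc j)) (n * suc j) (n * suc j)) M
      ≡⟨ cong (λ y → seq y M) (monomial-hit (a (suc j)) (n * suc j)) ⟩
    seq (a (suc j)) M ∎

  seq-∑ⱼ-zero : ∀ M N → (∀ j → N ≢ n * suc j) → seq (∑ⱼ n a N) M ≡ 0ℚ
  seq-∑ⱼ-zero M N N≢ = trans (seq-∑≤ M N (λ i → monomial (a (suc i)) (n * suc i) N))
    (∑-zero N λ i _ → cong (λ y → seq y M) (monomial-miss (a (suc i)) (n * suc i) N (N≢ i)))

-- At level M, the coefficient of z^{nk} in exp(-Σ_j ζ(nj)/j z^{nj}) is
-- (-1)^k e_k, as both sides satisfy the same recursion in k.
seq-exp-zetaSeries : ∀ n .{{_ : NonTrivial n}} M k →
  seq ([z^ (n * k) ] exp (-ˢ zetaSeries n) (-zetaSeries-constantTerm n)) M ≡ signedMzv n M k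
seq-exp-zetaSeries n M k = trans
  (seq-exp M (-ˢ zetaSeries n) (-zetaSeries-constantTerm n) (n * k))
  (recursion-unique recursion (newton n M)
    (trans (cong (expSeries f) (ℕ.*-zeroʳ n)) (sym (signedMzv-zero n M))) k)
  where
  instance
    n-nonZero : NonZero n
    n-nonZero = ℕ.nonTrivial⇒nonZero n
  a : (j : ℕ) → .{{NonZero j}} → ℝ
  a j = ζ (n * j) {{ℕ.n≢0∧m>1⇒m*n>1 n j}} /ᴿ j
  f : ℕ → ℚ
  f i = seq ((-ˢ zetaSeries n) i) M
  n*1+j≢0 : ∀ j → 0 ≢ n * suc j
  n*1+j≢0 j eq = ℕ.<⇒≢ (ℕ.<-≤-trans (s≤s z≤n) (ℕ.m≤n*m (suc j) n)) eq
  f-zero : ∀ i → (∀ j → i ≢ n * suc j) → f i ≡ 0ℚ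
  f-zero i i≢ = cong -_ (seq-∑ⱼ-zero n a M i i≢)
  coefficients : ∀ i → shift (θ (λ i → f (n * i))) i ≡ negPowerSum n M i
  coefficients i = begin
    fromℕ (suc i) · - seq (∑ⱼ n a (n * suc i)) M
      ≡⟨ cong (λ t → fromℕ (suc i) · - t) (seq-∑ⱼ-multiple n a M i) ⟩
    fromℕ (suc i) · - (p · recip (suc i))
      ≡⟨ solve 3 (λ m p r → m :* :- (p :* r) := con (- 1ℚ) :* p :* (r :* m)) refl
           (fromℕ (suc i)) p (recip (suc i)) ⟩
    - 1ℚ · p · (recip (suc i) · fromℕ (suc i))
      ≡⟨ cong (_·_ (- 1ℚ · p)) (recip-mul i) ⟩
    - 1ℚ · p · 1ℚ
      ≡⟨ *-identityʳ (- 1ℚ · p) ⟩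
    - 1ℚ · p ∎
    where p = zetaPartial (n * suc i) M
  recursion : Recursion (negPowerSum n M) (λ i → expSeries f (n * i))
  recursion k = trans
    (expSeries-recursion n f (f-zero 0 n*1+j≢0)
      (λ i n∤i → f-zero i λ j eq → n∤i (subst (n ∣_) (sym eq) (ℕ.m∣m*n (suc j)))) k)
    (⊛-congʳ k (λ i → expSeries f (n * i)) λ i _ → coefficients i)

-- Rational combinations of products of zeta values

-- S M is, for every M, the M-th approximation of one combination of products
-- of zeta values.  Exact equality at each M makes the predicate stable under
-- the arithmetic below without any estimates.
IsCombination : (ℕ → ℚ) → Set
IsCombination S = ∃ λ (c : ZetaCombination) → ∀ M → S M ≡ seq (evaluate c) M

combination-resp : ∀ {S T : ℕ → ℚ} → (∀ M → T M ≡ S M) → IsCombination S → IsCombination T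
combination-resp T≡S (c , S≡c) = c , λ M → trans (T≡S M) (S≡c M)

evaluate-++ : ∀ c d M → seq (evaluate (c ++ d)) M ≡ seq (evaluate c) M + seq (evaluate d) M
evaluate-++ []             d M = sym (+-identityˡ _)
evaluate-++ ((q , ss) ∷ c) d M =
  trans (cong (_+_ (q · seq (evaluateProduct ss) M)) (evaluate-++ c d M))
    (sym (+-assoc (q · seq (evaluateProduct ss) M) _ _))

combination-+ : ∀ {S T} → IsCombination S → IsCombination T → IsCombination (λ M → S M + T M)
combination-+ (c , S≡c) (d , T≡d) =
  c ++ d , λ M → trans (cong₂ _+_ (S≡c M) (T≡d M)) (sym (evaluate-++ c d M))

combination-∑ : ∀ N {F : ℕ → ℕ → ℚ} → (∀ i → IsCombination (F i)) →
                IsCombination (λ M → ∑ N λ i → F i M)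
combination-∑ zero    h = h 0
combination-∑ (suc N) h = combination-+ (combination-∑ N h) (h (suc N))

combination-*ˡ : ∀ q {S} → IsCombination S → IsCombination (λ M → q · S M)
combination-*ˡ q (c , S≡c) =
  map scale c , λ M → trans (cong (_·_ q) (S≡c M)) (sym (evaluate-scale c M))
  where
  scale : ℚ × ZetaProduct → ℚ × ZetaProduct
  scale (r , ss) = q · r , ss
  evaluate-scale : ∀ c M → seq (evaluate (map scale c)) M ≡ q · seq (evaluate c) M
  evaluate-scale []             M = sym (*-zeroʳ q)
  evaluate-scale ((r , ss) ∷ c) M =
    trans (cong (_+_ (q · r · seq (evaluateProduct ss) M)) (evaluate-scale c M))
      (solve 4 (λ q r z y → q :* r :* z :+ q :* y := q :* (r :* z :+ y)) refl
        q r (seq (evaluateProduct ss) M) (seq (evaluate c) M))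

combination-ζ : ∀ s → NonTrivial s → IsCombination (zetaPartial s)
combination-ζ s s≥2 = (1ℚ , (s , s≥2) ∷ []) ∷ [] , λ M →
  solve 1 (λ z → z := con 1ℚ :* (z :* con 1ℚ) :+ con 0ℚ) refl (zetaPartial s M)

combination-ζ* : ∀ s → NonTrivial s → ∀ {S} → IsCombination S →
                 IsCombination (λ M → zetaPartial s M · S M)
combination-ζ* s s≥2 (c , S≡c) = map multiply c , λ M →
  trans (cong (_·_ (zetaPartial s M)) (S≡c M)) (sym (evaluate-multiply c M))
  where
  multiply : ℚ × ZetaProduct → ℚ × ZetaProduct
  multiply (r , ss) = r , (s , s≥2) ∷⁺ ss
  evaluate-multiply : ∀ c M → seq (evaluate (map multiply c)) M ≡ zetaPartial s M · seq (evaluate c) M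
  evaluate-multiply []             M = sym (*-zeroʳ (zetaPartial s M))
  evaluate-multiply ((r , ss) ∷ c) M =
    trans (cong (_+_ (r · (zetaPartial s M · seq (evaluateProduct ss) M))) (evaluate-multiply c M))
      (solve 4 (λ z r y e → r :* (z :* y) :+ z :* e := z :* (r :* y :+ e)) refl
        (zetaPartial s M) r (seq (evaluateProduct ss) M) (seq (evaluate c) M))

signedMzv-combination : ∀ n .{{_ : NonTrivial n}} k → IsCombination (λ M → signedMzv n M (suc k))
signedMzv-combination n = <-rec _ step
  where
  step : ∀ k → (∀ {l} → l ℕ.< k → IsCombination (λ M → signedMzv n M (suc l))) →
         IsCombination (λ M → signedMzv n M (suc k))
  step k ih = combination-resp solved
      (combination-*ˡ (recip (suc k)) (combination-∑ k λ i → combination-resp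
        (λ M → *-assoc (- 1ℚ) (zetaPartial (n * suc i) M) (signedMzv n M (k ∸ i)))
        (combination-*ˡ (- 1ℚ) (factor i (k ∸ i) (ℕ.m∸n≤m k i)))))
    where
    factor : ∀ i l → l ℕ.≤ k → IsCombination (λ M → zetaPartial (n * suc i) M · signedMzv n M l)
    -- As signedMzv n M 0 = 1, the product is a single zeta value.
    factor i zero    _   = combination-resp
      (λ M → trans (cong (_·_ (zetaPartial (n * suc i) M)) (signedMzv-zero n M)) (*-identityʳ _))
      (combination-ζ (n * suc i) (ℕ.n≢0∧m>1⇒m*n>1 n (suc i)))
    factor i (suc l) l<k = combination-ζ* (n * suc i) (ℕ.n≢0∧m>1⇒m*n>1 n (suc i)) (ih l<k)
    solved : ∀ M → signedMzv n M (suc k) ≡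
             recip (suc k) · ∑ k (λ i → negPowerSum n M i · signedMzv n M (k ∸ i))
    solved M = fromℕ-cancelˡ k (begin
      fromℕ (suc k) · signedMzv n M (suc k)
        ≡⟨ newton n M k ⟩
      (negPowerSum n M ⊛ signedMzv n M) k
        ≡⟨ ⊛-as-∑ (negPowerSum n M) (signedMzv n M) k ⟩
      T
        ≡⟨ *-identityˡ T ⟨
      1ℚ · T
        ≡⟨ cong (_· T) (fromℕ-recip k) ⟨
      fromℕ (suc k) · recip (suc k) · T
        ≡⟨ *-assoc (fromℕ (suc k)) (recip (suc k)) T ⟩
      fromℕ (suc k) · (recip (suc k) · T) ∎)
      where T = ∑ k (λ i → negPowerSum n M i · signedMzv n M (k ∸ i))

mzv-combination : ∀ n k .{{_ : NonTrivial n}} .{{_ : NonZero k}} → IsCombination (mzvPartial n k)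
mzv-combination n k@(suc l) = combination-resp (λ M → sym (sign-signedMzv n M k))
  (combination-*ˡ (sign k) (signedMzv-combination n l))

proposition3 : (n k : ℕ) .{{_ : NonTrivial n}} .{{_ : NonZero k}} →
    (∃ λ (c : ZetaCombination) → ζ⟨｛ n ｝^ k ⟩ ≃ evaluate c) ×
    (ζ⟨｛ n ｝^ k ⟩ ≃
      ((-ᴿ 1ᴿ) ^ᴿ k) *ᴿ ([z^ (n * k) ] exp (-ˢ zetaSeries n) (-zetaSeries-constantTerm n)))
proposition3 n k =
  (let c , mzv≡c = mzv-combination n k in c , pointwise⇒≃ ζ⟨｛ n ｝^ k ⟩ (evaluate c) mzv≡c) ,
  pointwise⇒≃ ζ⟨｛ n ｝^ k ⟩
    (((-ᴿ 1ᴿ) ^ᴿ k) *ᴿ ([z^ (n * k) ] exp (-ˢ zetaSeries n) (-zetaSeries-constantTerm n)))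
    (λ M → trans (sym (sign-signedMzv n M k))
      (sym (cong₂ _·_ (seq-sign M k) (seq-exp-zetaSeries n M k))))
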